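{- Let $n$ be any positive integer. Then $$\tau(n)=\tfrac{1}{2^3\cdot3^5\cdot5\cdot7}\left[3\cdot7\cdot691\,\sigma_3(n)+2^3\cdot5\cdot691\,\sigma_5(n)+2\cdot3\cdot7\cdot691\,\sigma_7(n)-13\cdot241\,\sigma_{11}(n)\right]$$ $$\qquad+\tfrac{691\cdot2^2}{3^3}\sum_{m=1}^{n-1}\left[\sigma_3(m)\sigma_7(n-m)-\sigma_5(m)\sigma_5(n-m)\right]$$ and $$\tau(n)=\tfrac{1}{2^3\cdot3^5\cdot5\cdot7}\sum_{d\mid n,\,d>0}d^3\left(3\cdot7\cdot691+2^3\cdot5\cdot691\,d^2+2\cdot3\cdot7\cdot691\,d^4-13\cdot241\,d^8\right)$$ $$\qquad+\tfrac{691\cdot2^2}{3^3}\sum_{\substack{m_1>m_2\ge1\\ m_1+m_2\le n\\ \gcd(m_1,m_2)\mid n}}(m_1m_2)^3(m_1^2-m_2^2)^2\sum_{\substack{y_1,y_2\ge1\\ m_1y_1+m_2y_2=n}}1,$$ where $m_1,m_2,y_1,y_2$ range over integers.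
   Context: Ramanujan's tau function $\tau(n)$ is defined by $q\prod_{r\ge1}(1-q^r)^{24}=\sum_{n=1}^{\infty}\tau(n)q^n$. For positive integers $r,n$, $\sigma_r(n):=\sum_{d\mid n,\,d>0}d^r$. -}

module Defs where

open import Data.Nat.Base as ℕ using (ℕ; zero; suc; _∸_; _≤_; _<_; z≤n; s≤s)
import Data.Nat.Properties as ℕ
open import Data.Nat.Divisibility using (_∣_; _∣?_)
open import Data.Nat.GCD using (gcd)
import Data.Nat.ListAction as ℕ
open import Data.Integer.Base using (ℤ; 0ℤ; 1ℤ; _+_; _*_; _-_)
open import Data.Integer.Properties using (*-identityˡ; *-zeroˡ; +-identityˡ; +-identityʳ)
open import Data.Bool.Base using (if_then_else_)
open import Data.List.Base using (List; []; _∷_; map; foldr; filter; upTo; applyUpTo; cartesianProduct)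
open import Data.Product.Base using (_×_; _,_)
open import Function.Base using (_∘_)
open import Relation.Nullary.Decidable using (_×-dec_)
open import Relation.Binary.PropositionalEquality using (_≡_; refl; sym; trans; cong; cong₂)

∑ : {A : Set} → List A → (A → ℤ) → ℤ
∑ xs f = foldr _+_ 0ℤ (map f xs)

infix 5 ∑
syntax ∑ xs (λ x → e) = ∑[ x ∈ xs ] e

-- The list 1, 2, …, n.
range : ℕ → List ℕ
range n = map suc (upTo n)

-- For n ≥ 1 every positive divisor of n occurs in range n.
divisors : ℕ → List ℕ
divisors n = filter (_∣? n) (range n)

σ : ℕ → ℕ → ℕ
σ r n = ℕ.sum (map (ℕ._^ r) (divisors n))

-- Formal power series in q over ℤ, given by their coefficients.
Series : Set
Series = ℕ → ℤ

q^ : ℕ → Series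
q^ r n = if r ℕ.≡ᵇ n then 1ℤ else 0ℤ

𝟙 : Series
𝟙 = q^ 0

_⊖_ : Series → Series → Series
(f ⊖ g) n = f n - g n

_⊛_ : Series → Series → Series
(f ⊛ g) n = ∑[ i ∈ upTo (suc n) ] f i * g (n ∸ i)

_⊛^_ : Series → ℕ → Series
f ⊛^ zero  = 𝟙
f ⊛^ suc k = f ⊛ (f ⊛^ k)

∏≤ : (ℕ → Series) → ℕ → Series
∏≤ f zero    = 𝟙
∏≤ f (suc N) = f (suc N) ⊛ ∏≤ f N

-- The infinite product of f r over r ≥ 1, for families with f r ≡ 1 mod q^r.
-- For these the n-th coefficient of the partial products is constant from
-- the n-th partial product on (∏≤-stable), so the limit has the diagonal
-- coefficients below.
∏∞ : (ℕ → Series) → Series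
∏∞ f n = ∏≤ f n n

euler : ℕ → Series
euler r = (𝟙 ⊖ q^ r) ⊛^ 24

τ : ℕ → ℤ
τ = q^ 1 ⊛ ∏∞ euler

-- For n ≥ 1: the pairs (m₁ , m₂) with m₁ > m₂ ≥ 1, m₁ + m₂ ≤ n and
-- gcd m₁ m₂ ∣ n; the bound on m₁ + m₂ confines both to range n.
coefficientPairs : ℕ → List (ℕ × ℕ)
coefficientPairs n =
  filter (λ (m₁ , m₂) → (m₂ ℕ.<? m₁) ×-dec (m₁ ℕ.+ m₂ ℕ.≤? n) ×-dec (gcd m₁ m₂ ∣? n))
         (cartesianProduct (range n) (range n))

-- For m₁, m₂ ≥ 1: the pairs (y₁ , y₂) with y₁, y₂ ≥ 1 and
-- m₁ y₁ + m₂ y₂ = n; necessarily y₁, y₂ ≤ n.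
solutions : ℕ → ℕ → ℕ → List (ℕ × ℕ)
solutions m₁ m₂ n =
  filter (λ (y₁ , y₂) → m₁ ℕ.* y₁ ℕ.+ m₂ ℕ.* y₂ ℕ.≟ n)
         (cartesianProduct (range n) (range n))

infix 4 _≡1-mod-q^_
_≡1-mod-q^_ : Series → ℕ → Set
f ≡1-mod-q^ r = ∀ i → i < r → f i ≡ 𝟙 i

private
  ∑-zero : ∀ (h : ℕ → ℤ) (g : ℕ → ℕ) k → (∀ i → i < k → h (g i) ≡ 0ℤ) →
           ∑ (applyUpTo g k) h ≡ 0ℤ
  ∑-zero h g zero    z = refl
  ∑-zero h g (suc k) z =
    cong₂ _+_ (z 0 (s≤s z≤n)) (∑-zero h (g ∘ suc) k (λ i i<k → z (suc i) (s≤s i<k)))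

⊛-low : ∀ {f r} g n → f ≡1-mod-q^ r → n < r → (f ⊛ g) n ≡ g n
⊛-low {f} g n f≡1 n<r = trans (cong₂ _+_ first rest) (+-identityʳ (g n))
  where
  first : f 0 * g n ≡ g n
  first = trans (cong (_* g n) (f≡1 0 (ℕ.≤-<-trans z≤n n<r))) (*-identityˡ (g n))
  rest : ∑ (applyUpTo suc n) (λ i → f i * g (n ∸ i)) ≡ 0ℤ
  rest = ∑-zero _ suc n λ i i<n →
    trans (cong (_* g (n ∸ suc i)) (f≡1 (suc i) (ℕ.≤-<-trans i<n n<r)))
          (*-zeroˡ (g (n ∸ suc i)))

⊛-≡1 : ∀ {f g r} → f ≡1-mod-q^ r → g ≡1-mod-q^ r → f ⊛ g ≡1-mod-q^ r
⊛-≡1 {g = g} f≡1 g≡1 i i<r = trans (⊛-low g i f≡1 i<r) (g≡1 i i<r)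

⊛^-≡1 : ∀ {f r} k → f ≡1-mod-q^ r → f ⊛^ k ≡1-mod-q^ r
⊛^-≡1 zero    f≡1 i i<r = refl
⊛^-≡1 (suc k) f≡1       = ⊛-≡1 f≡1 (⊛^-≡1 k f≡1)

∏≤-stable : ∀ f → (∀ r → f r ≡1-mod-q^ r) → ∀ n k → ∏≤ f (k ℕ.+ n) n ≡ ∏∞ f n
∏≤-stable f f≡1 n zero    = refl
∏≤-stable f f≡1 n (suc k) =
  trans (⊛-low (∏≤ f (k ℕ.+ n)) n (f≡1 (suc k ℕ.+ n)) (s≤s (ℕ.m≤n+m n k)))
        (∏≤-stable f f≡1 n k)

private
  1-q^r≡1 : ∀ r → 𝟙 ⊖ q^ r ≡1-mod-q^ r
  1-q^r≡1 r i i<r = trans (cong (𝟙 i -_) (q^-low r i i<r)) (+-identityʳ (𝟙 i))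
    where
    q^-low : ∀ r i → i < r → q^ r i ≡ 0ℤ
    q^-low (suc r) zero    _         = refl
    q^-low (suc r) (suc i) (s≤s i<r) = q^-low r i i<r

euler-≡1 : ∀ r → euler r ≡1-mod-q^ r
euler-≡1 r = ⊛^-≡1 {𝟙 ⊖ q^ r} {r} 24 (1-q^r≡1 r)

{-# OPTIONS --safe #-}

-- Let S be the set of (a , b , x , y) with positive entries and a x + b y = n. The bijections
-- (a , b , x , y) ↦ (a , a + b , x − y , y) from {x > y} to {a < b} and (a , b , x , y) ↦ (b , a , y , x) give, for
-- every f, two expressions of Σ_S f(a , b) by sums over {a < b}, with boundary terms from a = b and x = y. Applied
-- to g₁ and g₂ built from an even polynomial F (see Polynomials), the sums over {a < b} agree, and
-- Σ_S (g₁ − g₂) becomes a sum of powers over the divisors of n. Suitable F yield the convolutions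
-- σ₁ * σ₃, σ₃ * σ₃, σ₁ * σ₅ and 8 σ₃ * σ₇ + 10 σ₅ * σ₅ as combinations of divisor functions.
-- In terms of Eisenstein series the first three say E₄² = E₈, 3 ∂E₄ = E₂ E₄ − E₆ and 2 ∂E₆ = E₂ E₆ − E₄², with
-- ∂ = q d/dq. Hence E₄³ − E₆² has logarithmic derivative E₂; so has q ∏ (1 − q^r)^24, factor by factor, and therefore
-- E₄ E₈ − E₆² = 1728 Σ τ(n) q^n. Combined with the fourth convolution this is the first formula; the second is
-- the first with its convolution sum split according to (a , b).
module Submission where

-- The obstacle is the cusp form. In weights 6 and 8 each convolution used is a combination of
-- divisor functions and of terms n σ_r(n). In weight 12 neither σ₃ * σ₇ nor σ₅ * σ₅ is one: each
-- also involves τ. Up to a factor, 8 σ₃ * σ₇ + 10 σ₅ * σ₅ is the only combination of the two from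
-- which τ drops out, so it is what counting representations can deliver. A second, independent
-- combination has to bring τ in; it is the n-th coefficient of E₄ E₈ - E₆². The two linear
-- equations are then solved for σ₃ * σ₇ - σ₅ * σ₅. The product and E₄ E₈ - E₆² are compared through
-- ∂f = E₂ f because this equation is linear and leaves only the coefficient of q free: two
-- coefficients decide, and everything stays over ℤ.

open import Defs
open import Data.Nat.Base as ℕ using (ℕ; zero; suc; NonZero; _∸_; _⊓_; _⊔_; _≤_; _<_; z≤n; s≤s; >-nonZero)
import Data.Nat.ListAction as ℕ
import Data.Nat.Properties as ℕ
open import Data.Nat.Divisibility using (_∣_; divides; _∣?_; ∣⇒≤; ∣-refl; ∣m∣n⇒∣m+n; ∣m+n∣m⇒∣n; ∣m⇒∣m*n)
open import Data.Nat.DivMod using (m/n*n≡m; m*n/n≡m)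
open import Data.Nat.GCD using (gcd; gcd[m,n]∣m; gcd[m,n]∣n)
open import Data.Nat.Induction using (<-rec)
open import Data.Integer.Base as ℤ using (ℤ; +_; 0ℤ; 1ℤ; +[1+_])
import Data.Integer.Properties as ℤ
open import Data.Integer.Solver using (module +-*-Solver)
open import Data.Rational.Base as ℚ using (ℚ; _/_; toℚᵘ)
import Data.Rational.Properties as ℚ
open import Data.Rational.Unnormalised.Base as ℚᵘ using (mkℚᵘ; *≡*)
import Data.Rational.Unnormalised.Properties as ℚᵘ
open import Data.Bool.Base using (Bool; true; false; if_then_else_)
open import Data.Fin.Base using (zero; suc)
open import Data.List.Base using (List; []; _∷_; [_]; _++_; map; filter; length; upTo; applyUpTo; cartesianProduct)
open import Data.List.Properties using (length-map; length-upTo; map-applyUpTo; map-++; applyUpTo-∷ʳ)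
open import Data.List.Membership.Propositional using (_∈_)
open import Data.List.Membership.Propositional.Properties
  using (∈-filter⁺; ∈-filter⁻; ∈-map⁺; ∈-map⁻; ∈-upTo⁺; ∈-upTo⁻; ∈-cartesianProduct⁺; ∈-cartesianProduct⁻)
open import Data.List.Relation.Unary.All as All using (All)
open import Data.List.Relation.Unary.AllPairs using (_∷_)
open import Data.List.Relation.Unary.Any using (here; there)
open import Data.List.Relation.Unary.Unique.Propositional using (Unique)
import Data.List.Relation.Unary.Unique.Propositional.Properties as Unique
open import Data.Maybe.Base as Maybe using (Maybe)
open import Data.Product.Base using (_×_; _,_; proj₁; proj₂)
open import Data.Product.Properties using (≡-dec)
open import Data.Sum.Base using (inj₁; inj₂)
open import Data.Vec.Base using ([]; _∷_)
open import Function.Base using (_∘_; flip; id)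
open import Function.Bundles using (mk⇔)
open import Level using (0ℓ)
open import Relation.Nullary using (yes; no; does; contradiction)
open import Relation.Nullary.Decidable using (_×-dec_; dec-true; dec-false; dec⇒maybe; does-⇔)
open import Relation.Unary using (Decidable)
open import Relation.Binary.Definitions using (DecidableEquality; tri<; tri≈; tri>)
open import Relation.Binary.PropositionalEquality
  using (_≡_; _≗_; refl; sym; trans; cong; cong₂; subst; module ≡-Reasoning)
open import Algebra.Bundles using (CommutativeRing)
open import Algebra.Bundles.Raw using (RawRing)
open import Algebra.Properties.CommutativeSemigroup ℤ.+-commutativeSemigroup using (interchange)
import Algebra.Solver.Ring
open import Algebra.Solver.Ring.AlmostCommutativeRing
  using (_-Raw-AlmostCommutative⟶_; fromCommutativeRing; -raw-almostCommutative⟶)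

-- Polynomial identities

-- Stated over an arbitrary commutative ring R, with the coefficients mapped in by φ, so that the operations stay
-- neutral: over ℤ itself _*_ unfolds, with exponential growth, when the solver's normal forms are compared.
module Polynomials
  (R : CommutativeRing 0ℓ 0ℓ)
  (φ : CommutativeRing.rawRing ℤ.+-*-commutativeRing -Raw-AlmostCommutative⟶ fromCommutativeRing R)
  where

  open CommutativeRing R
    using (Carrier; _≈_; _+_; _*_; _-_; -_; setoid; +-cong; +-congˡ; +-congʳ; *-congˡ; *-congʳ)
    renaming (refl to ≈-refl; reflexive to ≈-reflexive)
  open import Algebra.Definitions.RawSemiring (RawRing.rawSemiring (CommutativeRing.rawRing R)) using (_^_) public
  open _-Raw-AlmostCommutative⟶_ φ using () renaming (⟦_⟧ to infix 9 #_)
  open import Relation.Binary.Reasoning.Setoid setoid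

  _≟#_ : ∀ i j → Maybe (# i ≈ # j)
  i ≟# j = Maybe.map (λ i≡j → ≈-reflexive (cong #_ i≡j)) (dec⇒maybe (i ℤ.≟ j))

  open Algebra.Solver.Ring (CommutativeRing.rawRing ℤ.+-*-commutativeRing) (fromCommutativeRing R) φ _≟#_

  -- For even `F`, replacing b by -b turns each term of `g₁` into the term of `g₂` below it, the
  -- third one after negating both arguments. So `g₁ F − g₂ F` is odd in b and, being unchanged
  -- under (a , b) ↦ (-a , -b), odd in a as well: only convolutions of odd-index divisor functions
  -- arise.
  g₁ g₂ : (Carrier → Carrier → Carrier) → Carrier → Carrier → Carrier
  g₁ F a b = F a b + F a (a - b) + F (b - a) b
  g₂ F a b = F a (- b) + F a (a + b) + F (a + b) b

  ⟪_⟫ : (∀ {n} → Polynomial n → Polynomial n → Polynomial n) → Carrier → Carrier → Carrier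
  ⟪ P ⟫ x y = ⟦ P (var zero) (var (suc zero)) ⟧ (x ∷ y ∷ [])

  Evenness : (Carrier → Carrier → Carrier) → Set
  Evenness F = ∀ x y → F (- x) (- y) ≈ F x y

  -- On x = y the number d = a + b divides n, and `g₂ F` is summed over all a + b = d. An
  -- antidifference in a reduces this sum to two end values.
  Antidifference : (F K : Carrier → Carrier → Carrier) → ℤ → Set
  Antidifference F K c = ∀ a d → # c * g₂ F a (d - a) ≈ K d (# (+ 1) + a) - K d a

  monomials : List (ℤ × ℕ × ℕ) → Carrier → Carrier → Carrier
  monomials []                 a b = # (+ 0)
  monomials ((k , r , s) ∷ ms) a b = # k * (a ^ r * b ^ s) + monomials ms a b

  Interior : (Carrier → Carrier → Carrier) → List (ℤ × ℕ × ℕ) → Set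
  Interior F ms = ∀ a b → g₁ F a b - g₂ F a b ≈ monomials ms a b

  powers : List (Carrier × ℕ) → Carrier → Carrier
  powers []             d = # (+ 0)
  powers ((k , r) ∷ ps) d = k * d ^ r + powers ps d

  -- n = d (1 + p): there are p pairs (x , y) of positive numbers with d x + d y = n.
  Boundary : (F K : Carrier → Carrier → Carrier) → ℤ → (Carrier → List (Carrier × ℕ)) → Set
  Boundary F K c ps = ∀ d p → # c * (p * g₁ F d d) - (K d d - K d (# (+ 1))) ≈ powers (ps (d * (# (+ 1) + p))) d

  g₁ₚ g₂ₚ : ∀ {n} → (Polynomial n → Polynomial n → Polynomial n) → Polynomial n → Polynomial n → Polynomial n
  g₁ₚ F a b = F a b :+ F a (a :- b) :+ F (b :- a) b
  g₂ₚ F a b = F a (:- b) :+ F a (a :+ b) :+ F (a :+ b) b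

  monomialsₚ : ∀ {n} → List (ℤ × ℕ × ℕ) → Polynomial n → Polynomial n → Polynomial n
  monomialsₚ []                 a b = con (+ 0)
  monomialsₚ ((k , r , s) ∷ ms) a b = con k :* (a :^ r :* b :^ s) :+ monomialsₚ ms a b

  powersₚ : ∀ {n} → List (Polynomial n × ℕ) → Polynomial n → Polynomial n
  powersₚ []             d = con (+ 0)
  powersₚ ((k , r) ∷ ps) d = k :* d :^ r :+ powersₚ ps d

  -- Each F is a combination of the monomials x^i y^j of its degree chosen so that, up to the symmetry of a and b,
  -- only the wanted odd monomials survive in g₁ F − g₂ F. The antidifferences K come from Faulhaber's formula,
  -- scaled by the common denominator of their coefficients.

  Fₚ₁₃ Kₚ₁₃ : ∀ {n} → Polynomial n → Polynomial n → Polynomial n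
  Fₚ₁₃ x y = con (+ 1) :* (x :^ 2 :* y :^ 2)
  Kₚ₁₃ d a =
    a :* (con (ℤ.- + 1) :+ con (+ 15) :* d :^ 2 :+ con (+ 30) :* d :^ 3 :+ con (+ 30) :* d :^ 4 :+ a :*
    (con (ℤ.- + 15) :* d :^ 1 :+ con (ℤ.- + 45) :* d :^ 2 :+ con (ℤ.- + 30) :* d :^ 3 :+ a :*
    (con (+ 10) :+ con (+ 30) :* d :^ 1 :+ con (+ 30) :* d :^ 2 :+ a :*
    (con (ℤ.- + 15) :+ con (ℤ.- + 15) :* d :^ 1 :+ a :*
    (con (+ 6))))))

  F₁₃ K₁₃ : Carrier → Carrier → Carrier
  F₁₃ = ⟪ Fₚ₁₃ ⟫
  K₁₃ = ⟪ Kₚ₁₃ ⟫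

  ms₁₃ : List (ℤ × ℕ × ℕ)
  ms₁₃ = (ℤ.- + 4 , 1 , 3) ∷ (ℤ.- + 4 , 3 , 1) ∷ []

  ps₁₃ : Carrier → List (Carrier × ℕ)
  ps₁₃ n = (# (+ 30) * n , 3) ∷ (# (ℤ.- + 21) , 5) ∷ (# (ℤ.- + 10) , 3) ∷ (# (+ 1) , 1) ∷ []

  even₁₃ : Evenness F₁₃
  even₁₃ = solve 2 (λ x y → Fₚ₁₃ (:- x) (:- y) := Fₚ₁₃ x y) ≈-refl

  antidifference₁₃ : Antidifference F₁₃ K₁₃ (+ 30)
  antidifference₁₃ = solve 2 (λ a d →
    con (+ 30) :* g₂ₚ Fₚ₁₃ a (d :- a)
    := Kₚ₁₃ d (con (+ 1) :+ a) :- Kₚ₁₃ d a) ≈-refl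

  interior₁₃ : Interior F₁₃ ms₁₃
  interior₁₃ = solve 2 (λ a b →
    g₁ₚ Fₚ₁₃ a b :- g₂ₚ Fₚ₁₃ a b
    := monomialsₚ ms₁₃ a b) ≈-refl

  boundary₁₃ : Boundary F₁₃ K₁₃ (+ 30) ps₁₃
  boundary₁₃ = solve 2 (λ d p →
    con (+ 30) :* (p :* g₁ₚ Fₚ₁₃ d d) :- (Kₚ₁₃ d d :- Kₚ₁₃ d (con (+ 1)))
    := powersₚ ((con (+ 30) :* (d :* (con (+ 1) :+ p)) , 3) ∷ (con (ℤ.- + 21) , 5) ∷ (con (ℤ.- + 10) , 3) ∷ (con (+ 1) , 1) ∷ []) d) ≈-refl

  Fₚ₃₃ Kₚ₃₃ : ∀ {n} → Polynomial n → Polynomial n → Polynomial n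
  Fₚ₃₃ x y = con (+ 1) :* (x :^ 2 :* y :^ 4) :+ con (ℤ.- + 1) :* (x :^ 3 :* y :^ 3)
  Kₚ₃₃ d a =
    a :* (con (ℤ.- + 8) :* d :^ 2 :+ con (+ 50) :* d :^ 4 :+ con (+ 30) :* d :^ 5 :+ a :*
    (con (+ 5) :* d :^ 1 :+ con (ℤ.- + 105) :* d :^ 3 :+ con (ℤ.- + 150) :* d :^ 4 :+ con (ℤ.- + 30) :* d :^ 5 :+ a :*
    (con (+ 80) :* d :^ 2 :+ con (+ 210) :* d :^ 3 :+ con (+ 100) :* d :^ 4 :+ a :*
    (con (ℤ.- + 25) :* d :^ 1 :+ con (ℤ.- + 120) :* d :^ 2 :+ con (ℤ.- + 105) :* d :^ 3 :+ a :*
    (con (+ 30) :* d :^ 1 :+ con (+ 48) :* d :^ 2 :+ a :*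
    (con (ℤ.- + 10) :* d :^ 1))))))

  F₃₃ K₃₃ : Carrier → Carrier → Carrier
  F₃₃ = ⟪ Fₚ₃₃ ⟫
  K₃₃ = ⟪ Kₚ₃₃ ⟫

  ms₃₃ : List (ℤ × ℕ × ℕ)
  ms₃₃ = (+ 2 , 1 , 5) ∷ (ℤ.- + 6 , 3 , 3) ∷ (ℤ.- + 2 , 5 , 1) ∷ []

  ps₃₃ : Carrier → List (Carrier × ℕ)
  ps₃₃ n = (# (ℤ.- + 3) , 7) ∷ (# (+ 3) , 3) ∷ []

  even₃₃ : Evenness F₃₃
  even₃₃ = solve 2 (λ x y → Fₚ₃₃ (:- x) (:- y) := Fₚ₃₃ x y) ≈-refl

  antidifference₃₃ : Antidifference F₃₃ K₃₃ (+ 60)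
  antidifference₃₃ = solve 2 (λ a d →
    con (+ 60) :* g₂ₚ Fₚ₃₃ a (d :- a)
    := Kₚ₃₃ d (con (+ 1) :+ a) :- Kₚ₃₃ d a) ≈-refl

  interior₃₃ : Interior F₃₃ ms₃₃
  interior₃₃ = solve 2 (λ a b →
    g₁ₚ Fₚ₃₃ a b :- g₂ₚ Fₚ₃₃ a b
    := monomialsₚ ms₃₃ a b) ≈-refl

  boundary₃₃ : Boundary F₃₃ K₃₃ (+ 60) ps₃₃
  boundary₃₃ = solve 2 (λ d p →
    con (+ 60) :* (p :* g₁ₚ Fₚ₃₃ d d) :- (Kₚ₃₃ d d :- Kₚ₃₃ d (con (+ 1)))
    := powersₚ ((con (ℤ.- + 3) , 7) ∷ (con (+ 3) , 3) ∷ []) d) ≈-refl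

  Fₚ₁₅ Kₚ₁₅ : ∀ {n} → Polynomial n → Polynomial n → Polynomial n
  Fₚ₁₅ x y = con (ℤ.- + 1) :* (x :^ 2 :* y :^ 4) :+ con (+ 4) :* (x :^ 3 :* y :^ 3)
  Kₚ₁₅ d a =
    a :* (con (+ 3) :+ con (ℤ.- + 7) :* d :^ 2 :+ con (+ 28) :* d :^ 4 :+ con (+ 168) :* d :^ 5 :+ con (+ 126) :* d :^ 6 :+ a :*
    (con (+ 28) :* d :^ 1 :+ con (+ 42) :* d :^ 3 :+ con (ℤ.- + 84) :* d :^ 4 :+ con (ℤ.- + 168) :* d :^ 5 :+ a :*
    (con (ℤ.- + 21) :+ con (+ 70) :* d :^ 2 :+ con (ℤ.- + 84) :* d :^ 3 :+ con (+ 56) :* d :^ 4 :+ a :*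
    (con (ℤ.- + 140) :* d :^ 1 :+ con (ℤ.- + 105) :* d :^ 2 :+ con (+ 42) :* d :^ 3 :+ a :*
    (con (+ 63) :+ con (+ 168) :* d :^ 1 :+ con (+ 42) :* d :^ 2 :+ a :*
    (con (ℤ.- + 63) :+ con (ℤ.- + 56) :* d :^ 1 :+ a :*
    (con (+ 18))))))))

  F₁₅ K₁₅ : Carrier → Carrier → Carrier
  F₁₅ = ⟪ Fₚ₁₅ ⟫
  K₁₅ = ⟪ Kₚ₁₅ ⟫

  ms₁₅ : List (ℤ × ℕ × ℕ)
  ms₁₅ = (ℤ.- + 20 , 1 , 5) ∷ (ℤ.- + 16 , 5 , 1) ∷ []

  ps₁₅ : Carrier → List (Carrier × ℕ)
  ps₁₅ n = (# (+ 126) * n , 5) ∷ (# (ℤ.- + 60) , 7) ∷ (# (ℤ.- + 63) , 5) ∷ (# (ℤ.- + 3) , 1) ∷ []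

  even₁₅ : Evenness F₁₅
  even₁₅ = solve 2 (λ x y → Fₚ₁₅ (:- x) (:- y) := Fₚ₁₅ x y) ≈-refl

  antidifference₁₅ : Antidifference F₁₅ K₁₅ (+ 42)
  antidifference₁₅ = solve 2 (λ a d →
    con (+ 42) :* g₂ₚ Fₚ₁₅ a (d :- a)
    := Kₚ₁₅ d (con (+ 1) :+ a) :- Kₚ₁₅ d a) ≈-refl

  interior₁₅ : Interior F₁₅ ms₁₅
  interior₁₅ = solve 2 (λ a b →
    g₁ₚ Fₚ₁₅ a b :- g₂ₚ Fₚ₁₅ a b
    := monomialsₚ ms₁₅ a b) ≈-refl

  boundary₁₅ : Boundary F₁₅ K₁₅ (+ 42) ps₁₅
  boundary₁₅ = solve 2 (λ d p →
    con (+ 42) :* (p :* g₁ₚ Fₚ₁₅ d d) :- (Kₚ₁₅ d d :- Kₚ₁₅ d (con (+ 1)))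
    := powersₚ ((con (+ 126) :* (d :* (con (+ 1) :+ p)) , 5) ∷ (con (ℤ.- + 60) , 7) ∷ (con (ℤ.- + 63) , 5) ∷ (con (ℤ.- + 3) , 1) ∷ []) d) ≈-refl

  Fₚ₃₇ Kₚ₃₇ : ∀ {n} → Polynomial n → Polynomial n → Polynomial n
  Fₚ₃₇ x y = con (+ 1) :* (x :^ 4 :* y :^ 6) :+ con (ℤ.- + 1) :* (x :^ 5 :* y :^ 5)
  Kₚ₃₇ d a =
    a :* (con (ℤ.- + 210) :* d :^ 2 :+ con (+ 330) :* d :^ 4 :+ con (ℤ.- + 504) :* d :^ 6 :+ con (+ 1050) :* d :^ 8 :+ con (+ 630) :* d :^ 9 :+ a :*
    (con (+ 189) :* d :^ 1 :+ con (ℤ.- + 1050) :* d :^ 3 :+ con (+ 1155) :* d :^ 5 :+ con (ℤ.- + 3150) :* d :^ 7 :+ con (ℤ.- + 3150) :* d :^ 8 :+ con (ℤ.- + 630) :* d :^ 9 :+ a :*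
    (con (+ 1400) :* d :^ 2 :+ con (ℤ.- + 2310) :* d :^ 4 :+ con (+ 5040) :* d :^ 6 :+ con (+ 6300) :* d :^ 7 :+ con (+ 2100) :* d :^ 8 :+ a :*
    (con (ℤ.- + 630) :* d :^ 1 :+ con (+ 3675) :* d :^ 3 :+ con (ℤ.- + 5775) :* d :^ 5 :+ con (ℤ.- + 7560) :* d :^ 6 :+ con (ℤ.- + 3150) :* d :^ 7 :+ a :*
    (con (ℤ.- + 2940) :* d :^ 2 :+ con (+ 6930) :* d :^ 4 :+ con (+ 6930) :* d :^ 5 :+ con (+ 3024) :* d :^ 6 :+ a :*
    (con (+ 882) :* d :^ 1 :+ con (ℤ.- + 7350) :* d :^ 3 :+ con (ℤ.- + 6930) :* d :^ 4 :+ con (ℤ.- + 2310) :* d :^ 5 :+ a :*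
    (con (+ 4200) :* d :^ 2 :+ con (+ 6300) :* d :^ 3 :+ con (+ 1980) :* d :^ 4 :+ a :*
    (con (ℤ.- + 945) :* d :^ 1 :+ con (ℤ.- + 3150) :* d :^ 2 :+ con (ℤ.- + 1575) :* d :^ 3 :+ a :*
    (con (+ 630) :* d :^ 1 :+ con (+ 700) :* d :^ 2 :+ a :*
    (con (ℤ.- + 126) :* d :^ 1))))))))))

  F₃₇ K₃₇ : Carrier → Carrier → Carrier
  F₃₇ = ⟪ Fₚ₃₇ ⟫
  K₃₇ = ⟪ Kₚ₃₇ ⟫

  ms₃₇ : List (ℤ × ℕ × ℕ)
  ms₃₇ =
    (+ 2 , 1 , 9) ∷ (+ 12 , 3 , 7) ∷ (ℤ.- + 10 , 5 , 5) ∷ (ℤ.- + 20 , 7 , 3) ∷ (ℤ.- + 2 , 9 , 1) ∷ []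

  ps₃₇ : Carrier → List (Carrier × ℕ)
  ps₃₇ n = (# (ℤ.- + 13) , 11) ∷ (# (+ 42) , 7) ∷ (# (ℤ.- + 50) , 5) ∷ (# (+ 21) , 3) ∷ []

  even₃₇ : Evenness F₃₇
  even₃₇ = solve 2 (λ x y → Fₚ₃₇ (:- x) (:- y) := Fₚ₃₇ x y) ≈-refl

  antidifference₃₇ : Antidifference F₃₇ K₃₇ (+ 1260)
  antidifference₃₇ = solve 2 (λ a d →
    con (+ 1260) :* g₂ₚ Fₚ₃₇ a (d :- a)
    := Kₚ₃₇ d (con (+ 1) :+ a) :- Kₚ₃₇ d a) ≈-refl

  interior₃₇ : Interior F₃₇ ms₃₇
  interior₃₇ = solve 2 (λ a b →
    g₁ₚ Fₚ₃₇ a b :- g₂ₚ Fₚ₃₇ a b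
    := monomialsₚ ms₃₇ a b) ≈-refl

  boundary₃₇ : Boundary F₃₇ K₃₇ (+ 1260) ps₃₇
  boundary₃₇ = solve 2 (λ d p →
    con (+ 1260) :* (p :* g₁ₚ Fₚ₃₇ d d) :- (Kₚ₃₇ d d :- Kₚ₃₇ d (con (+ 1)))
    := powersₚ ((con (ℤ.- + 13) , 11) ∷ (con (+ 42) , 7) ∷ (con (ℤ.- + 50) , 5) ∷ (con (+ 21) , 3) ∷ []) d) ≈-refl

  -- Collecting terms into linear relations

  module Relations (C : ℕ → ℕ → Carrier) (S : ℕ → Carrier) where

    -- `C r s` and `S r` stand for the n-th coefficients of σ_r * σ_s and σ_r. Convolution is
    -- commutative, so a^r b^s and a^s b^r are filed under one sorted pair; this cancels the (1 , 5)
    -- terms of `ms₃₃` and the (1 , 9) terms of `ms₃₇`.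
    interior-sum : List (ℤ × ℕ × ℕ) → Carrier
    interior-sum []                 = # (+ 0)
    interior-sum ((k , r , s) ∷ ms) = # k * C (r ⊓ s) (r ⊔ s) + interior-sum ms

    boundary-sum : List (Carrier × ℕ) → Carrier
    boundary-sum []             = # (+ 0)
    boundary-sum ((k , r) ∷ ps) = k * S r + boundary-sum ps

    lhs₁₃ : # (+ 240) * C 1 3 ≈ - (# (+ 30) * interior-sum ms₁₃)
    lhs₁₃ = solve 1 (λ c → con (+ 240) :* c
      := :- (con (+ 30) :* (con (ℤ.- + 4) :* c :+ (con (ℤ.- + 4) :* c :+ con (+ 0))))) ≈-refl (C 1 3)

    rhs₁₃ : ∀ n → - boundary-sum (ps₁₃ n) ≈ # (+ 21) * S 5 + # (+ 10) * S 3 - S 1 - # (+ 30) * (n * S 3)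
    rhs₁₃ n = solve 4 (λ n s₁ s₃ s₅ →
      :- (con (+ 30) :* n :* s₃ :+ (con (ℤ.- + 21) :* s₅ :+ (con (ℤ.- + 10) :* s₃ :+ (con (+ 1) :* s₁ :+ con (+ 0)))))
      := con (+ 21) :* s₅ :+ con (+ 10) :* s₃ :- s₁ :- con (+ 30) :* (n :* s₃)) ≈-refl n (S 1) (S 3) (S 5)

    lhs₃₃ : # (+ 3) * (# (+ 120) * C 3 3) ≈ - (# (+ 60) * interior-sum ms₃₃)
    lhs₃₃ = solve 2 (λ c₁₅ c₃₃ → con (+ 3) :* (con (+ 120) :* c₃₃)
      := :- (con (+ 60) :* (con (+ 2) :* c₁₅ :+ (con (ℤ.- + 6) :* c₃₃ :+ (con (ℤ.- + 2) :* c₁₅ :+ con (+ 0)))))) ≈-refl (C 1 5) (C 3 3)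

    rhs₃₃ : ∀ n → - boundary-sum (ps₃₃ n) ≈ # (+ 3) * (S 7 - S 3)
    rhs₃₃ n = solve 2 (λ s₃ s₇ → :- (con (ℤ.- + 3) :* s₇ :+ (con (+ 3) :* s₃ :+ con (+ 0)))
      := con (+ 3) :* (s₇ :- s₃)) ≈-refl (S 3) (S 7)

    lhs₁₅ : # (+ 3) * (# (+ 504) * C 1 5) ≈ - (# (+ 42) * interior-sum ms₁₅)
    lhs₁₅ = solve 1 (λ c → con (+ 3) :* (con (+ 504) :* c)
      := :- (con (+ 42) :* (con (ℤ.- + 20) :* c :+ (con (ℤ.- + 16) :* c :+ con (+ 0))))) ≈-refl (C 1 5)

    rhs₁₅ : ∀ n → - boundary-sum (ps₁₅ n) ≈ # (+ 3) * (# (+ 20) * S 7 + # (+ 21) * S 5 + S 1 - # (+ 42) * (n * S 5))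
    rhs₁₅ n = solve 4 (λ n s₁ s₅ s₇ →
      :- (con (+ 126) :* n :* s₅ :+ (con (ℤ.- + 60) :* s₇ :+ (con (ℤ.- + 63) :* s₅ :+ (con (ℤ.- + 3) :* s₁ :+ con (+ 0)))))
      := con (+ 3) :* (con (+ 20) :* s₇ :+ con (+ 21) :* s₅ :+ s₁ :- con (+ 42) :* (n :* s₅))) ≈-refl n (S 1) (S 5) (S 7)

    left₁₂ right₁₂ : Carrier
    left₁₂  = # (+ 1260) * (# (+ 8) * C 3 7 + # (+ 10) * C 5 5)
    right₁₂ = # (+ 13) * S 11 - # (+ 42) * S 7 + # (+ 50) * S 5 - # (+ 21) * S 3

    lhs₃₇ : left₁₂ ≈ - (# (+ 1260) * interior-sum ms₃₇)
    lhs₃₇ = solve 3 (λ c₁₉ c₃₇ c₅₅ → con (+ 1260) :* (con (+ 8) :* c₃₇ :+ con (+ 10) :* c₅₅)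
      := :- (con (+ 1260) :* (con (+ 2) :* c₁₉ :+ (con (+ 12) :* c₃₇ :+ (con (ℤ.- + 10) :* c₅₅
        :+ (con (ℤ.- + 20) :* c₃₇ :+ (con (ℤ.- + 2) :* c₁₉ :+ con (+ 0)))))))) ≈-refl (C 1 9) (C 3 7) (C 5 5)

    rhs₃₇ : ∀ n → - boundary-sum (ps₃₇ n) ≈ right₁₂
    rhs₃₇ n = solve 4 (λ s₃ s₅ s₇ s₁₁ →
      :- (con (ℤ.- + 13) :* s₁₁ :+ (con (+ 42) :* s₇ :+ (con (ℤ.- + 50) :* s₅ :+ (con (+ 21) :* s₃ :+ con (+ 0)))))
      := con (+ 13) :* s₁₁ :- con (+ 42) :* s₇ :+ con (+ 50) :* s₅ :- con (+ 21) :* s₃) ≈-refl (S 3) (S 5) (S 7) (S 11)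

    -- The n-th coefficient of E₄ E₈ - E₆² when `e` is that of the series 1. Here 115200 = 240 · 480
    -- and 254016 = 504².
    discriminant₁₂ : Carrier → Carrier
    discriminant₁₂ e =
      (e + # (+ 480) * S 7 + (# (+ 240) * S 3 + # (+ 115200) * C 3 7))
      - (e + # (ℤ.- + 504) * S 5 + (# (ℤ.- + 504) * S 5 + # (+ 254016) * C 5 5))

    -- 14511 = 3 · 7 · 691, 27640 = 2³ · 5 · 691, 29022 = 2 · 3 · 7 · 691 and 3133 = 13 · 241.
    weighted : Carrier
    weighted = # (+ 14511) * S 3 + # (+ 27640) * S 5 + # (+ 29022) * S 7 - # (+ 3133) * S 11

    -- 8 · 68040 = 315 · 1728 makes the two discriminants match (8505 = 315 · 27);
    -- 52056 = 8 · 27 · 241 is the multiple of the weight 12 relation that accounts for 13 · 241 σ₁₁.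
    τ-combination : ∀ e t x y → discriminant₁₂ e ≈ # (+ 1728) * t → left₁₂ ≈ right₁₂ → x ≈ weighted → y ≈ C 3 7 - C 5 5 →
      # (+ 8) * (t * (# (+ 68040) * # (+ 27))) ≈ # (+ 8) * (# (+ 1) * x * # (+ 27) + # (+ 2764) * y * # (+ 68040))
    τ-combination e t x y discriminant-≈ relation x≈ y≈ = begin
      # (+ 8) * (t * (# (+ 68040) * # (+ 27)))
        ≈⟨ solve 1 (λ t → con (+ 8) :* (t :* (con (+ 68040) :* con (+ 27))) := con (+ 8505) :* (con (+ 1728) :* t)) ≈-refl t ⟩
      # (+ 8505) * (# (+ 1728) * t)
        ≈⟨ *-congˡ discriminant-≈ ⟨
      # (+ 8505) * discriminant₁₂ e
        ≈⟨ solve 7 (λ e s₃ s₅ s₇ s₁₁ c₃₇ c₅₅ →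
             con (+ 8505) :* ((e :+ con (+ 480) :* s₇ :+ (con (+ 240) :* s₃ :+ con (+ 115200) :* c₃₇))
               :- (e :+ con (ℤ.- + 504) :* s₅ :+ (con (ℤ.- + 504) :* s₅ :+ con (+ 254016) :* c₅₅)))
             := con (+ 8) :* (con (+ 1) :* (con (+ 14511) :* s₃ :+ con (+ 27640) :* s₅ :+ con (+ 29022) :* s₇ :- con (+ 3133) :* s₁₁) :* con (+ 27)
                  :+ con (+ 2764) :* (c₃₇ :- c₅₅) :* con (+ 68040))
               :+ con (+ 52056) :* ((con (+ 13) :* s₁₁ :- con (+ 42) :* s₇ :+ con (+ 50) :* s₅ :- con (+ 21) :* s₃)
                 :- con (+ 1260) :* (con (+ 8) :* c₃₇ :+ con (+ 10) :* c₅₅)))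
             ≈-refl e (S 3) (S 5) (S 7) (S 11) (C 3 7) (C 5 5) ⟩
      # (+ 8) * (# (+ 1) * weighted * # (+ 27) + # (+ 2764) * (C 3 7 - C 5 5) * # (+ 68040)) + # (+ 52056) * (right₁₂ - left₁₂)
        ≈⟨ +-congˡ (*-congˡ (+-congʳ relation)) ⟨
      # (+ 8) * (# (+ 1) * weighted * # (+ 27) + # (+ 2764) * (C 3 7 - C 5 5) * # (+ 68040)) + # (+ 52056) * (left₁₂ - left₁₂)
        ≈⟨ solve 2 (λ u v → u :+ con (+ 52056) :* (v :- v) := u) ≈-refl
             (# (+ 8) * (# (+ 1) * weighted * # (+ 27) + # (+ 2764) * (C 3 7 - C 5 5) * # (+ 68040))) left₁₂ ⟩
      # (+ 8) * (# (+ 1) * weighted * # (+ 27) + # (+ 2764) * (C 3 7 - C 5 5) * # (+ 68040))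
        ≈⟨ *-congˡ (+-cong (*-congʳ (*-congˡ x≈)) (*-congʳ (*-congˡ y≈))) ⟨
      # (+ 8) * (# (+ 1) * x * # (+ 27) + # (+ 2764) * y * # (+ 68040)) ∎

  -- The weight of the second formula is a³ b⁷ - a⁵ b⁵ symmetrised in a and b.
  product-difference : ∀ a b → (a * b) ^ 3 * (a ^ 2 - b ^ 2) ^ 2 ≈ (b ^ 3 * a ^ 7 - b ^ 5 * a ^ 5) + (a ^ 3 * b ^ 7 - a ^ 5 * b ^ 5)
  product-difference = solve 2 (λ a b → (a :* b) :^ 3 :* (a :^ 2 :- b :^ 2) :^ 2
    := (b :^ 3 :* a :^ 7 :- b :^ 5 :* a :^ 5) :+ (a :^ 3 :* b :^ 7 :- a :^ 5 :* b :^ 5)) ≈-refl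

module Pℤ = Polynomials ℤ.+-*-commutativeRing
  (-raw-almostCommutative⟶ (fromCommutativeRing ℤ.+-*-commutativeRing))

open import Data.Integer.Base using (_+_; _-_; -_; _*_; _^_)
open ≡-Reasoning
open +-*-Solver using (solve; _:=_; _:+_; _:*_; _:-_; :-_; con)

-- Finite sums

+-congˡ : ∀ i {j k} → j ≡ k → i + j ≡ i + k
+-congˡ i = cong (λ j → i + j)

∑-cong∈ : {A : Set} (xs : List A) {f g : A → ℤ} → (∀ {x} → x ∈ xs → f x ≡ g x) → ∑ xs f ≡ ∑ xs g
∑-cong∈ []       eq = refl
∑-cong∈ (x ∷ xs) eq = cong₂ _+_ (eq (here refl)) (∑-cong∈ xs (eq ∘ there))

∑-cong : {A : Set} (xs : List A) {f g : A → ℤ} → (∀ x → f x ≡ g x) → ∑ xs f ≡ ∑ xs g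
∑-cong xs eq = ∑-cong∈ xs λ {x} _ → eq x

∑-0 : {A : Set} (xs : List A) → ∑ xs (λ _ → 0ℤ) ≡ 0ℤ
∑-0 []       = refl
∑-0 (x ∷ xs) = trans (ℤ.+-identityˡ _) (∑-0 xs)

∑-+ : {A : Set} (xs : List A) (f g : A → ℤ) → ∑ xs (λ x → f x + g x) ≡ ∑ xs f + ∑ xs g
∑-+ []       f g = refl
∑-+ (x ∷ xs) f g = trans (+-congˡ (f x + g x) (∑-+ xs f g)) (interchange (f x) (g x) _ _)

∑-*ˡ : {A : Set} (xs : List A) (c : ℤ) (f : A → ℤ) → ∑ xs (λ x → c * f x) ≡ c * ∑ xs f
∑-*ˡ []       c f = sym (ℤ.*-zeroʳ c)
∑-*ˡ (x ∷ xs) c f = trans (+-congˡ (c * f x) (∑-*ˡ xs c f)) (sym (ℤ.*-distribˡ-+ c (f x) _))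

∑-- : {A : Set} (xs : List A) (f g : A → ℤ) → ∑ xs (λ x → f x - g x) ≡ ∑ xs f - ∑ xs g
∑-- xs f g = begin
  ∑ xs (λ x → f x - g x)                 ≡⟨ ∑-+ xs f (λ x → - g x) ⟩
  ∑ xs f + ∑ xs (λ x → - g x)            ≡⟨ +-congˡ (∑ xs f) (∑-cong xs λ x → sym (ℤ.-1*i≡-i (g x))) ⟩
  ∑ xs f + ∑ xs (λ x → - 1ℤ * g x)       ≡⟨ +-congˡ (∑ xs f) (trans (∑-*ˡ xs (- 1ℤ) g) (ℤ.-1*i≡-i _)) ⟩
  ∑ xs f - ∑ xs g                        ∎

∑-comm : {A B : Set} (xs : List A) (ys : List B) (f : A → B → ℤ) →
         ∑ xs (λ x → ∑ ys (f x)) ≡ ∑ ys (λ y → ∑ xs (flip f y))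
∑-comm []       ys f = sym (∑-0 ys)
∑-comm (x ∷ xs) ys f = trans (+-congˡ (∑ ys (f x)) (∑-comm xs ys f)) (sym (∑-+ ys (f x) _))

∑-map : {A B : Set} (h : A → B) (xs : List A) (f : B → ℤ) → ∑ (map h xs) f ≡ ∑ xs (f ∘ h)
∑-map h []       f = refl
∑-map h (x ∷ xs) f = +-congˡ (f (h x)) (∑-map h xs f)

∑-++ : {A : Set} (xs ys : List A) (f : A → ℤ) → ∑ (xs ++ ys) f ≡ ∑ xs f + ∑ ys f
∑-++ []       ys f = sym (ℤ.+-identityˡ _)
∑-++ (x ∷ xs) ys f = trans (+-congˡ (f x) (∑-++ xs ys f)) (sym (ℤ.+-assoc (f x) _ _))

∑-× : {A B : Set} (xs : List A) (ys : List B) (f : A → ℤ) (g : B → ℤ) →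
      ∑ (cartesianProduct xs ys) (λ (x , y) → f x * g y) ≡ ∑ xs f * ∑ ys g
∑-× []       ys f g = refl
∑-× (x ∷ xs) ys f g = begin
  ∑ (map (x ,_) ys ++ cartesianProduct xs ys) _  ≡⟨ ∑-++ (map (x ,_) ys) _ _ ⟩
  ∑ (map (x ,_) ys) _ + ∑ (cartesianProduct xs ys) _
    ≡⟨ cong₂ _+_ (trans (∑-map (x ,_) ys _) (∑-*ˡ ys (f x) g)) (∑-× xs ys f g) ⟩
  f x * ∑ ys g + ∑ xs f * ∑ ys g                 ≡⟨ sym (ℤ.*-distribʳ-+ (∑ ys g) (f x) _) ⟩
  (f x + ∑ xs f) * ∑ ys g                        ∎

when : Bool → ℤ → ℤ
when b v = if b then v else 0ℤ

∑-filter : {A : Set} {P : A → Set} (P? : Decidable P) (xs : List A) (f : A → ℤ) →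
           ∑ (filter P? xs) f ≡ ∑ xs (λ x → when (does (P? x)) (f x))
∑-filter P? []       f = refl
∑-filter P? (x ∷ xs) f with does (P? x)
... | true  = +-congˡ (f x) (∑-filter P? xs f)
... | false = trans (∑-filter P? xs f) (sym (ℤ.+-identityˡ _))

∑-δ : {A : Set} (_≟_ : DecidableEquality A) {xs : List A} {x : A} → Unique xs → x ∈ xs → (f : A → ℤ) →
      ∑ xs (λ y → when (does (x ≟ y)) (f y)) ≡ f x
∑-δ _≟_ {x ∷ xs} (x∉xs ∷ _) (here refl) f = trans (cong₂ _+_ here-≡ rest-≡) (ℤ.+-identityʳ (f x))
  where
  here-≡ : when (does (x ≟ x)) (f x) ≡ f x
  here-≡ rewrite dec-true (x ≟ x) refl = refl
  miss : ∀ {y} → y ∈ xs → when (does (x ≟ y)) (f y) ≡ 0ℤ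
  miss {y} y∈ rewrite dec-false (x ≟ y) (All.lookup x∉xs y∈) = refl
  rest-≡ : ∑ xs (λ y → when (does (x ≟ y)) (f y)) ≡ 0ℤ
  rest-≡ = trans (∑-cong∈ xs miss) (∑-0 xs)
∑-δ _≟_ {z ∷ xs} {x} (z∉xs ∷ u) (there x∈xs) f = trans (cong₂ _+_ miss (∑-δ _≟_ u x∈xs f)) (ℤ.+-identityˡ (f x))
  where
  miss : when (does (x ≟ z)) (f z) ≡ 0ℤ
  miss rewrite dec-false (x ≟ z) (λ x≡z → All.lookup z∉xs x∈xs (sym x≡z)) = refl

-- Insert the indicator of φ x = y and exchange the sums. On the two lists φ x = y holds exactly
-- when ψ y = x, so the double sum collapses either way.
∑-bijection : {A B : Set} → DecidableEquality A → DecidableEquality B →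
  {xs : List A} {ys : List B} → Unique xs → Unique ys →
  (φ : A → B) (ψ : B → A) →
  (∀ {x} → x ∈ xs → φ x ∈ ys × ψ (φ x) ≡ x) →
  (∀ {y} → y ∈ ys → ψ y ∈ xs × φ (ψ y) ≡ y) →
  (g : B → ℤ) → ∑ xs (g ∘ φ) ≡ ∑ ys g
∑-bijection _≟ᴬ_ _≟ᴮ_ {xs} {ys} uxs uys φ ψ φ-inv ψ-inv g = begin
  ∑ xs (g ∘ φ)
    ≡⟨ ∑-cong∈ xs (λ x∈ → sym (∑-δ _≟ᴮ_ uys (proj₁ (φ-inv x∈)) g)) ⟩
  ∑ xs (λ x → ∑ ys (λ y → when (does (φ x ≟ᴮ y)) (g y)))
    ≡⟨ ∑-comm xs ys _ ⟩
  ∑ ys (λ y → ∑ xs (λ x → when (does (φ x ≟ᴮ y)) (g y)))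
    ≡⟨ ∑-cong∈ ys (λ y∈ → trans (∑-cong∈ xs λ x∈ → cong (λ b → when b _) (transpose x∈ y∈)) (∑-δ _≟ᴬ_ uxs (proj₁ (ψ-inv y∈)) (λ _ → g _))) ⟩
  ∑ ys g ∎
  where
  transpose : ∀ {x y} → x ∈ xs → y ∈ ys → does (φ x ≟ᴮ y) ≡ does (ψ y ≟ᴬ x)
  transpose {x} {y} x∈ y∈ with ψ y ≟ᴬ x
  ... | yes refl = dec-true (_ ≟ᴮ _) (proj₂ (ψ-inv y∈))
  ... | no ψy≢x  = dec-false (_ ≟ᴮ _) λ { refl → ψy≢x (proj₂ (φ-inv x∈)) }

-- `ys` may exceed the image of `h`; the additional fibres are empty and contribute 0.
∑-fibres : {A B : Set} (_≟_ : DecidableEquality B) (h : A → B) (xs : List A) {ys : List B} → Unique ys →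
  (∀ {x} → x ∈ xs → h x ∈ ys) → (f : A → ℤ) →
  ∑ xs f ≡ ∑ ys (λ y → ∑ (filter (λ x → h x ≟ y) xs) f)
∑-fibres _≟_ h xs {ys} uys h∈ f = begin
  ∑ xs f
    ≡⟨ ∑-cong∈ xs (λ x∈ → sym (∑-δ _≟_ uys (h∈ x∈) (λ _ → f _))) ⟩
  ∑ xs (λ x → ∑ ys (λ y → when (does (h x ≟ y)) (f x)))
    ≡⟨ ∑-comm xs ys _ ⟩
  ∑ ys (λ y → ∑ xs (λ x → when (does (h x ≟ y)) (f x)))
    ≡⟨ ∑-cong ys (λ y → sym (∑-filter (λ x → h x ≟ y) xs f)) ⟩
  ∑ ys (λ y → ∑ (filter (λ x → h x ≟ y) xs) f) ∎

∑-trichotomy : {A : Set} (xs : List A) (h k : A → ℕ) (f : A → ℤ) →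
  ∑ xs f ≡ ∑ (filter (λ x → h x ℕ.<? k x) xs) f
         + ∑ (filter (λ x → k x ℕ.<? h x) xs) f
         + ∑ (filter (λ x → h x ℕ.≟ k x) xs) f
∑-trichotomy xs h k f = begin
  ∑ xs f
    ≡⟨ ∑-cong xs split ⟩
  ∑ xs (λ x → when (does (h x ℕ.<? k x)) (f x) + when (does (k x ℕ.<? h x)) (f x) + when (does (h x ℕ.≟ k x)) (f x))
    ≡⟨ trans (∑-+ xs _ _) (cong (λ s → s + ∑ xs (λ x → when (does (h x ℕ.≟ k x)) (f x))) (∑-+ xs _ _)) ⟩
  ∑ xs (λ x → when (does (h x ℕ.<? k x)) (f x)) + ∑ xs (λ x → when (does (k x ℕ.<? h x)) (f x)) + ∑ xs (λ x → when (does (h x ℕ.≟ k x)) (f x))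
    ≡⟨ sym (cong₂ _+_ (cong₂ _+_ (∑-filter _ xs f) (∑-filter _ xs f)) (∑-filter _ xs f)) ⟩
  _ ∎
  where
  split : ∀ x → f x ≡ when (does (h x ℕ.<? k x)) (f x) + when (does (k x ℕ.<? h x)) (f x) + when (does (h x ℕ.≟ k x)) (f x)
  split x with ℕ.<-cmp (h x) (k x)
  ... | tri< lt ne gt rewrite dec-true (h x ℕ.<? k x) lt | dec-false (k x ℕ.<? h x) gt | dec-false (h x ℕ.≟ k x) ne
        = sym (trans (ℤ.+-identityʳ _) (ℤ.+-identityʳ _))
  ... | tri≈ lt eq gt rewrite dec-false (h x ℕ.<? k x) lt | dec-false (k x ℕ.<? h x) gt | dec-true (h x ℕ.≟ k x) eq
        = sym (ℤ.+-identityˡ _)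
  ... | tri> lt ne gt rewrite dec-false (h x ℕ.<? k x) lt | dec-true (k x ℕ.<? h x) gt | dec-false (h x ℕ.≟ k x) ne
        = sym (trans (ℤ.+-identityʳ _) (ℤ.+-identityˡ _))

-- Representations n = a x + b y

∈-range⁺ : ∀ {i n} → 1 ≤ i → i ≤ n → i ∈ range n
∈-range⁺ {suc i} _ i<n = ∈-map⁺ suc (∈-upTo⁺ i<n)

∈-range⁻ : ∀ {i n} → i ∈ range n → 1 ≤ i × i ≤ n
∈-range⁻ i∈ with j , j∈ , refl ← ∈-map⁻ suc i∈ = s≤s z≤n , ∈-upTo⁻ j∈

range-unique : ∀ n → Unique (range n)
range-unique n = Unique.map⁺ ℕ.suc-injective (Unique.upTo⁺ n)

∈-divisors⁺ : ∀ {d n} → 1 ≤ n → d ∣ n → d ∈ divisors n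
∈-divisors⁺ {zero}  {n} 1≤n (divides q refl) = contradiction 1≤n (ℕ.<-irrefl (sym (ℕ.*-zeroʳ q)))
∈-divisors⁺ {suc d} {suc n} _ d∣n = ∈-filter⁺ (_∣? suc n) (∈-range⁺ (s≤s z≤n) (∣⇒≤ d∣n)) d∣n

∈-divisors⁻ : ∀ {d n} → d ∈ divisors n → 1 ≤ d × 1 ≤ n × d ∣ n
∈-divisors⁻ {d} {n} d∈ with d∈range , d∣n ← ∈-filter⁻ (_∣? n) {xs = range n} d∈
                       with 1≤d , d≤n ← ∈-range⁻ d∈range = 1≤d , ℕ.≤-trans 1≤d d≤n , d∣n

divisors-unique : ∀ n → Unique (divisors n)
divisors-unique n = Unique.filter⁺ (_∣? n) (range-unique n)

Quad : Set
Quad = ℕ × ℕ × ℕ × ℕ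

_≟²_ : DecidableEquality (ℕ × ℕ)
_≟²_ = ≡-dec ℕ._≟_ ℕ._≟_

_≟⁴_ : DecidableEquality Quad
_≟⁴_ = ≡-dec ℕ._≟_ (≡-dec ℕ._≟_ _≟²_)

IsRep : ℕ → Quad → Set
IsRep n (a , b , x , y) = 1 ≤ a × 1 ≤ b × 1 ≤ x × 1 ≤ y × a ℕ.* x ℕ.+ b ℕ.* y ≡ n

box : ℕ → List Quad
box n = cartesianProduct (range n) (cartesianProduct (range n) (cartesianProduct (range n) (range n)))

reps : ℕ → List Quad
reps n = filter (λ (a , b , x , y) → a ℕ.* x ℕ.+ b ℕ.* y ℕ.≟ n) (box n)

reps-unique : ∀ n → Unique (reps n)
reps-unique n = Unique.filter⁺ _ (Unique.cartesianProduct⁺ u (Unique.cartesianProduct⁺ u (Unique.cartesianProduct⁺ u u)))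
  where
  u : Unique (range n)
  u = range-unique n

≤-product : ∀ a x → 1 ≤ a → x ≤ a ℕ.* x
≤-product (suc a) x _ = ℕ.m≤m+n x (a ℕ.* x)

≤-product′ : ∀ a x → 1 ≤ x → a ≤ a ℕ.* x
≤-product′ a x 1≤x = subst (a ≤_) (ℕ.*-comm x a) (≤-product x a 1≤x)

∈-reps⁺ : ∀ {n t} → IsRep n t → t ∈ reps n
∈-reps⁺ {n} {a , b , x , y} (a⁺ , b⁺ , x⁺ , y⁺ , eq) =
  ∈-filter⁺ _ (∈-cartesianProduct⁺ (bound a⁺ (ℕ.≤-trans (≤-product′ a x x⁺) ax≤n))
              (∈-cartesianProduct⁺ (bound b⁺ (ℕ.≤-trans (≤-product′ b y y⁺) by≤n))
              (∈-cartesianProduct⁺ (bound x⁺ (ℕ.≤-trans (≤-product a x a⁺) ax≤n))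
                                   (bound y⁺ (ℕ.≤-trans (≤-product b y b⁺) by≤n))))) eq
  where
  bound = ∈-range⁺
  ax≤n : a ℕ.* x ≤ n
  ax≤n = subst (a ℕ.* x ≤_) eq (ℕ.m≤m+n (a ℕ.* x) (b ℕ.* y))
  by≤n : b ℕ.* y ≤ n
  by≤n = subst (b ℕ.* y ≤_) eq (ℕ.m≤n+m (b ℕ.* y) (a ℕ.* x))

∈-reps⁻ : ∀ {n t} → t ∈ reps n → IsRep n t
∈-reps⁻ {n} {a , b , x , y} t∈
  with t∈box , eq ← ∈-filter⁻ (λ (a , b , x , y) → a ℕ.* x ℕ.+ b ℕ.* y ℕ.≟ n) {xs = box n} t∈
  with a∈ , t∈′ ← ∈-cartesianProduct⁻ (range n) _ t∈box
  with b∈ , t∈″ ← ∈-cartesianProduct⁻ (range n) _ t∈′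
  with x∈ , y∈ ← ∈-cartesianProduct⁻ (range n) _ t∈″ = pos a∈ , pos b∈ , pos x∈ , pos y∈ , eq
  where
  pos : ∀ {i} → i ∈ range n → 1 ≤ i
  pos = proj₁ ∘ ∈-range⁻

∑-reindex : ∀ n {P Q : Quad → Set} (P? : Decidable P) (Q? : Decidable Q) (φ ψ : Quad → Quad) →
  (∀ t → IsRep n t → P t → IsRep n (φ t) × Q (φ t) × ψ (φ t) ≡ t) →
  (∀ t → IsRep n t → Q t → IsRep n (ψ t) × P (ψ t) × φ (ψ t) ≡ t) →
  (g : Quad → ℤ) → ∑ (filter P? (reps n)) (g ∘ φ) ≡ ∑ (filter Q? (reps n)) g
∑-reindex n P? Q? φ ψ φ-ok ψ-ok =
  ∑-bijection _≟⁴_ _≟⁴_ (Unique.filter⁺ P? (reps-unique n)) (Unique.filter⁺ Q? (reps-unique n)) φ ψ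
    (transfer P? Q? φ ψ φ-ok) (transfer Q? P? ψ φ ψ-ok)
  where
  transfer : ∀ {P Q : Quad → Set} (P? : Decidable P) (Q? : Decidable Q) (φ ψ : Quad → Quad) →
    (∀ t → IsRep n t → P t → IsRep n (φ t) × Q (φ t) × ψ (φ t) ≡ t) →
    ∀ {t} → t ∈ filter P? (reps n) → φ t ∈ filter Q? (reps n) × ψ (φ t) ≡ t
  transfer P? Q? φ ψ ok {t} t∈ with t∈reps , p ← ∈-filter⁻ P? {xs = reps n} t∈
                               with rep , q , inv ← ok t (∈-reps⁻ {n} {t} t∈reps) p
    = ∈-filter⁺ Q? (∈-reps⁺ rep) q , inv

a<b? : Decidable {A = Quad} λ (a , b , x , y) → a < b
a<b? (a , b , x , y) = a ℕ.<? b

b<a? : Decidable {A = Quad} λ (a , b , x , y) → b < a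
b<a? (a , b , x , y) = b ℕ.<? a

a≟b? : Decidable {A = Quad} λ (a , b , x , y) → a ≡ b
a≟b? (a , b , x , y) = a ℕ.≟ b

x<y? : Decidable {A = Quad} λ (a , b , x , y) → x < y
x<y? (a , b , x , y) = x ℕ.<? y

y<x? : Decidable {A = Quad} λ (a , b , x , y) → y < x
y<x? (a , b , x , y) = y ℕ.<? x

x≟y? : Decidable {A = Quad} λ (a , b , x , y) → x ≡ y
x≟y? (a , b , x , y) = x ℕ.≟ y

-- Swapping and shearing representations

coeffs : (ℕ → ℕ → ℤ) → Quad → ℤ
coeffs f (a , b , x , y) = f a b

swap : Quad → Quad
swap (a , b , x , y) = b , a , y , x

swap-rep : ∀ {n} t → IsRep n t → IsRep n (swap t)
swap-rep (a , b , x , y) (a⁺ , b⁺ , x⁺ , y⁺ , eq) = b⁺ , a⁺ , y⁺ , x⁺ , trans (ℕ.+-comm (b ℕ.* y) (a ℕ.* x)) eq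

∑-swap-ab : ∀ n g → ∑ (filter b<a? (reps n)) (g ∘ swap) ≡ ∑ (filter a<b? (reps n)) g
∑-swap-ab n = ∑-reindex n b<a? a<b? swap swap
  (λ t rep p → swap-rep t rep , p , refl) (λ t rep q → swap-rep t rep , q , refl)

∑-swap-xy : ∀ n g → ∑ (filter x<y? (reps n)) (g ∘ swap) ≡ ∑ (filter y<x? (reps n)) g
∑-swap-xy n = ∑-reindex n x<y? y<x? swap swap
  (λ t rep p → swap-rep t rep , p , refl) (λ t rep q → swap-rep t rep , q , refl)

-- a x + b y = a (x − y) + (a + b) y
∑-shear : ∀ n (f : ℕ → ℕ → ℤ) →
  ∑ (filter y<x? (reps n)) (coeffs f) ≡ ∑ (filter a<b? (reps n)) (coeffs λ a b → f a (b ∸ a))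
∑-shear n f = sym (∑-reindex n a<b? y<x? φ ψ φ-ok ψ-ok (coeffs f))
  where
  φ ψ : Quad → Quad
  φ (a , b , x , y) = a , b ∸ a , x ℕ.+ y , y
  ψ (a , b , x , y) = a , a ℕ.+ b , x ∸ y , y

  expand : ∀ a c x y → a ℕ.* (x ℕ.+ y) ℕ.+ c ℕ.* y ≡ a ℕ.* x ℕ.+ (a ℕ.+ c) ℕ.* y
  expand a c x y = begin
    a ℕ.* (x ℕ.+ y) ℕ.+ c ℕ.* y              ≡⟨ cong (ℕ._+ c ℕ.* y) (ℕ.*-distribˡ-+ a x y) ⟩
    a ℕ.* x ℕ.+ a ℕ.* y ℕ.+ c ℕ.* y          ≡⟨ ℕ.+-assoc (a ℕ.* x) (a ℕ.* y) (c ℕ.* y) ⟩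
    a ℕ.* x ℕ.+ (a ℕ.* y ℕ.+ c ℕ.* y)        ≡⟨ cong (a ℕ.* x ℕ.+_) (ℕ.*-distribʳ-+ y a c) ⟨
    a ℕ.* x ℕ.+ (a ℕ.+ c) ℕ.* y              ∎

  φ-ok : ∀ t → IsRep n t → proj₁ t < proj₁ (proj₂ t) → _
  φ-ok (a , b , x , y) (a⁺ , b⁺ , x⁺ , y⁺ , eq) a<b =
    (a⁺ , ℕ.m<n⇒0<n∸m a<b , ℕ.≤-trans x⁺ (ℕ.m≤m+n x y) , y⁺ ,
      trans (expand a (b ∸ a) x y) (trans (cong (λ c → a ℕ.* x ℕ.+ c ℕ.* y) (ℕ.m+[n∸m]≡n (ℕ.<⇒≤ a<b))) eq)) ,
    ℕ.m<n+m y x⁺ ,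
    cong₂ (λ b x → a , b , x , y) (ℕ.m+[n∸m]≡n (ℕ.<⇒≤ a<b)) (ℕ.m+n∸n≡m x y)

  ψ-ok : ∀ t → IsRep n t → proj₂ (proj₂ (proj₂ t)) < proj₁ (proj₂ (proj₂ t)) → _
  ψ-ok (a , b , x , y) (a⁺ , b⁺ , x⁺ , y⁺ , eq) y<x =
    (a⁺ , ℕ.≤-trans a⁺ (ℕ.m≤m+n a b) , ℕ.m<n⇒0<n∸m y<x , y⁺ ,
      trans (sym (expand a b (x ∸ y) y)) (trans (cong (λ x → a ℕ.* x ℕ.+ b ℕ.* y) (ℕ.m∸n+n≡m (ℕ.<⇒≤ y<x))) eq)) ,
    ℕ.m<m+n a b⁺ ,
    cong₂ (λ b x → a , b , x , y) (ℕ.m+n∸m≡n a b) (ℕ.m∸n+n≡m (ℕ.<⇒≤ y<x))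

∑-split-ab : ∀ n (f : ℕ → ℕ → ℤ) → ∑ (reps n) (coeffs f) ≡
  ∑ (filter a<b? (reps n)) (coeffs λ a b → f a b + f b a) + ∑ (filter a≟b? (reps n)) (coeffs f)
∑-split-ab n f = trans (∑-trichotomy (reps n) (λ (a , b , x , y) → a) (λ (a , b , x , y) → b) (coeffs f))
  (cong (λ s → s + ∑ (filter a≟b? (reps n)) (coeffs f))
    (trans (+-congˡ (∑ (filter a<b? (reps n)) (coeffs f)) (∑-swap-ab n (coeffs (flip f))))
           (sym (∑-+ (filter a<b? (reps n)) (coeffs f) (coeffs (flip f))))))

∑-split-xy : ∀ n (f : ℕ → ℕ → ℤ) → ∑ (reps n) (coeffs f) ≡
  ∑ (filter a<b? (reps n)) (coeffs λ a b → f a (b ∸ a) + f (b ∸ a) a) + ∑ (filter x≟y? (reps n)) (coeffs f)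
∑-split-xy n f = trans (∑-trichotomy (reps n) (λ (a , b , x , y) → x) (λ (a , b , x , y) → y) (coeffs f))
  (cong (λ s → s + ∑ (filter x≟y? (reps n)) (coeffs f)) (begin
    ∑ (filter x<y? (reps n)) (coeffs f) + ∑ (filter y<x? (reps n)) (coeffs f)
      ≡⟨ cong₂ _+_ (trans (∑-swap-xy n (coeffs (flip f))) (∑-shear n (flip f))) (∑-shear n f) ⟩
    ∑ (filter a<b? (reps n)) (coeffs λ a b → f (b ∸ a) a) + ∑ (filter a<b? (reps n)) (coeffs λ a b → f a (b ∸ a))
      ≡⟨ ℤ.+-comm (∑ (filter a<b? (reps n)) (coeffs λ a b → f (b ∸ a) a)) _ ⟩
    ∑ (filter a<b? (reps n)) (coeffs λ a b → f a (b ∸ a)) + ∑ (filter a<b? (reps n)) (coeffs λ a b → f (b ∸ a) a)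
      ≡⟨ sym (∑-+ (filter a<b? (reps n)) _ _) ⟩
    ∑ (filter a<b? (reps n)) (coeffs λ a b → f a (b ∸ a) + f (b ∸ a) a) ∎))

-- `g₁` is split by comparing a with b, `g₂` by comparing x with y; both leave a sum over {a < b}.
-- With b = a + c the hypothesis matches the two summands, c being the `b ∸ a` that the shear
-- produces.
∑-descent : ∀ n (g₁ g₂ : ℕ → ℕ → ℤ) →
  (∀ a c → g₁ a (a ℕ.+ c) + g₁ (a ℕ.+ c) a ≡ g₂ a c + g₂ c a) →
  ∑ (reps n) (coeffs g₁) - ∑ (reps n) (coeffs g₂)
    ≡ ∑ (filter a≟b? (reps n)) (coeffs g₁) - ∑ (filter x≟y? (reps n)) (coeffs g₂)
∑-descent n g₁ g₂ eq = begin
  ∑ (reps n) (coeffs g₁) - ∑ (reps n) (coeffs g₂)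
    ≡⟨ cong₂ _-_ (trans (∑-split-ab n g₁) (cong (λ s → s + E) (∑-cong∈ (filter a<b? (reps n)) λ {t} → agree t))) (∑-split-xy n g₂) ⟩
  (L + E) - (L + X)
    ≡⟨ cancel L E X ⟩
  E - X ∎
  where
  cancel : ∀ i j k → (i + j) - (i + k) ≡ j - k
  cancel = solve 3 (λ i j k → (i :+ j) :- (i :+ k) := j :- k) refl
  L E X : ℤ
  L = ∑ (filter a<b? (reps n)) (coeffs λ a b → g₂ a (b ∸ a) + g₂ (b ∸ a) a)
  E = ∑ (filter a≟b? (reps n)) (coeffs g₁)
  X = ∑ (filter x≟y? (reps n)) (coeffs g₂)
  agree : ∀ t → t ∈ filter a<b? (reps n) →
          coeffs (λ a b → g₁ a b + g₁ b a) t ≡ coeffs (λ a b → g₂ a (b ∸ a) + g₂ (b ∸ a) a) t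
  agree (a , b , x , y) t∈ = subst (λ c → g₁ a c + g₁ c a ≡ g₂ a (b ∸ a) + g₂ (b ∸ a) a)
    (ℕ.m+[n∸m]≡n (ℕ.<⇒≤ (proj₂ (∈-filter⁻ a<b? {xs = reps n} t∈)))) (eq a (b ∸ a))

-- Evaluating sums over representations fibre by fibre

quot : ℕ → ℕ → ℕ
-- A default value, which frees the inverse maps below from nonzero side conditions; the laws of
-- `quot` are stated for positive a.
quot m zero    = 0
quot m (suc a) = m ℕ./ suc a

quot-unique : ∀ {a x m} → 1 ≤ a → a ℕ.* x ≡ m → quot m a ≡ x
quot-unique {suc a} {x} _ refl = trans (cong (ℕ._/ suc a) (ℕ.*-comm (suc a) x)) (m*n/n≡m x (suc a))

quot-* : ∀ {a m} → 1 ≤ a → a ∣ m → a ℕ.* quot m a ≡ m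
quot-* {suc a} {m} _ a∣m = trans (ℕ.*-comm (suc a) (m ℕ./ suc a)) (m/n*n≡m a∣m)

quot-pos : ∀ {a m} → 1 ≤ m → 1 ≤ a → a ∣ m → 1 ≤ quot m a
quot-pos {a} {m} 1≤m 1≤a a∣m with quot m a | quot-* 1≤a a∣m
... | zero  | eq = contradiction 1≤m (ℕ.<-irrefl (trans (sym (ℕ.*-zeroʳ a)) eq))
... | suc q | eq = s≤s z≤n

-- A fibre is evaluated by parametrising it: φ reads off the free coordinate, ψ rebuilds the
-- quadruple from it.
∑-fibre : ∀ n {P : Quad → Set} (P? : Decidable P) {B C : Set} (_≟ᴮ_ : DecidableEquality B) (_≟ᶜ_ : DecidableEquality C)
  (h : Quad → B) (z : B) {ys : List C} → Unique ys → (φ : Quad → C) (ψ : C → Quad) →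
  (∀ t → IsRep n t → P t → h t ≡ z → φ t ∈ ys × ψ (φ t) ≡ t) →
  (∀ {y} → y ∈ ys → (IsRep n (ψ y) × P (ψ y) × h (ψ y) ≡ z) × φ (ψ y) ≡ y) →
  (g : C → ℤ) → ∑ (filter (λ t → h t ≟ᴮ z) (filter P? (reps n))) (g ∘ φ) ≡ ∑ ys g
∑-fibre n P? _≟ᴮ_ _≟ᶜ_ h z {ys} uys φ ψ φ-ok ψ-ok =
  ∑-bijection _≟⁴_ _≟ᶜ_ (Unique.filter⁺ h? (Unique.filter⁺ P? (reps-unique n))) uys φ ψ φ-ok′ ψ-ok′
  where
  h? : Decidable (λ t → h t ≡ z)
  h? t = h t ≟ᴮ z
  φ-ok′ : ∀ {t} → t ∈ filter h? (filter P? (reps n)) → φ t ∈ ys × ψ (φ t) ≡ t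
  φ-ok′ {t} t∈ with t∈P , eq ← ∈-filter⁻ h? {xs = filter P? (reps n)} t∈
               with t∈reps , p ← ∈-filter⁻ P? {xs = reps n} t∈P = φ-ok t (∈-reps⁻ {n} {t} t∈reps) p eq
  ψ-ok′ : ∀ {y} → y ∈ ys → ψ y ∈ filter h? (filter P? (reps n)) × φ (ψ y) ≡ y
  ψ-ok′ y∈ with (rep , p , eq) , inv ← ψ-ok y∈ = ∈-filter⁺ h? (∈-filter⁺ P? (∈-reps⁺ rep) p) eq , inv

∑-const : {A : Set} (xs : List A) (c : ℤ) → ∑ xs (λ _ → c) ≡ + length xs * c
∑-const []       c = sym (ℤ.*-zeroˡ c)
∑-const (x ∷ xs) c = trans (+-congˡ c (∑-const xs c)) (sym (ℤ.suc-* (+ length xs) c))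

length-range : ∀ n → length (range n) ≡ n
length-range n = trans (length-map suc (upTo n)) (length-upTo n)

-- For a = b = d the equation reads d (x + y) = n. If n = d (1 + p), then x runs over 1, ..., p and
-- y = 1 + p - x, so d contributes p times the value g(d , d).
∑-a≡b : ∀ n (g : ℕ → ℕ → ℤ) (k : ℕ → ℤ) →
  (∀ d p → 1 ≤ d → d ℕ.* suc p ≡ n → + p * g d d ≡ k d) →
  ∑ (filter a≟b? (reps n)) (coeffs g) ≡ ∑ (divisors n) k
∑-a≡b n g k eq = begin
  ∑ (filter a≟b? (reps n)) (coeffs g)
    ≡⟨ ∑-fibres ℕ._≟_ proj₁ (filter a≟b? (reps n)) (divisors-unique n) (λ {t} → a∈divisors t) (coeffs g) ⟩
  ∑ (divisors n) (λ d → ∑ (filter (λ t → proj₁ t ℕ.≟ d) (filter a≟b? (reps n))) (coeffs g))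
    ≡⟨ ∑-cong∈ (divisors n) fibre ⟩
  ∑ (divisors n) k ∎
  where
  factor : ∀ a x y → a ℕ.* x ℕ.+ a ℕ.* y ≡ n → a ℕ.* (x ℕ.+ y) ≡ n
  factor a x y e = trans (ℕ.*-distribˡ-+ a x y) e

  a∈divisors : ∀ t → t ∈ filter a≟b? (reps n) → proj₁ t ∈ divisors n
  a∈divisors t@(a , b , x , y) t∈
    with t∈reps , refl ← ∈-filter⁻ a≟b? {xs = reps n} t∈
    with a⁺ , _ , x⁺ , _ , e ← ∈-reps⁻ {n} {t} t∈reps
    = ∈-divisors⁺ (ℕ.≤-trans a⁺ (ℕ.≤-trans (≤-product′ a x x⁺) (subst (a ℕ.* x ≤_) e (ℕ.m≤m+n (a ℕ.* x) (a ℕ.* y)))))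
                  (divides (x ℕ.+ y) (sym (trans (ℕ.*-comm (x ℕ.+ y) a) (factor a x y e))))

  fibre : ∀ {d} → d ∈ divisors n → ∑ (filter (λ t → proj₁ t ℕ.≟ d) (filter a≟b? (reps n))) (coeffs g) ≡ k d
  fibre {d} d∈ with d⁺ , n⁺ , d∣n ← ∈-divisors⁻ {d} {n} d∈ with quot n d | quot-* {d} {n} d⁺ d∣n | quot-pos {d} {n} n⁺ d⁺ d∣n
  -- `quot-pos` rules out the quotient 0.
  ... | suc p | dq≡n | _ = begin
    ∑ F (coeffs g)
      ≡⟨ ∑-cong∈ F constant ⟩
    ∑ F (λ _ → g d d)
      ≡⟨ ∑-fibre n a≟b? ℕ._≟_ ℕ._≟_ proj₁ d (range-unique p) (λ (a , b , x , y) → x) (λ x → d , d , x , suc p ∸ x) φ-ok ψ-ok (λ _ → g d d) ⟩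
    ∑ (range p) (λ _ → g d d)
      ≡⟨ ∑-const (range p) (g d d) ⟩
    + length (range p) * g d d
      ≡⟨ cong (λ l → + l * g d d) (length-range p) ⟩
    + p * g d d
      ≡⟨ eq d p d⁺ dq≡n ⟩
    k d ∎
    where
    F : List Quad
    F = filter (λ t → proj₁ t ℕ.≟ d) (filter a≟b? (reps n))
    constant : ∀ {t} → t ∈ F → coeffs g t ≡ g d d
    constant {a , b , x , y} t∈ with t∈′ , refl ← ∈-filter⁻ (λ t → proj₁ t ℕ.≟ d) {xs = filter a≟b? (reps n)} t∈
                                with _ , refl ← ∈-filter⁻ a≟b? {xs = reps n} t∈′ = refl
    x+y≡q : ∀ {x y} → d ℕ.* x ℕ.+ d ℕ.* y ≡ n → x ℕ.+ y ≡ suc p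
    x+y≡q {x} {y} e = ℕ.*-cancelˡ-≡ (x ℕ.+ y) (suc p) d {{>-nonZero d⁺}} (trans (factor d x y e) (sym dq≡n))
    φ-ok : ∀ t → IsRep n t → proj₁ t ≡ proj₁ (proj₂ t) → proj₁ t ≡ d → _
    φ-ok (a , b , x , y) (_ , _ , x⁺ , y⁺ , e) refl refl =
      ∈-range⁺ x⁺ (ℕ.≤-pred (subst (suc x ≤_) (trans (ℕ.+-comm y x) (x+y≡q e)) (ℕ.+-monoˡ-≤ x y⁺))) ,
      cong (λ y → d , d , x , y) (trans (cong (_∸ x) (sym (x+y≡q e))) (ℕ.m+n∸m≡n x y))
    ψ-ok : ∀ {x} → x ∈ range p → _
    ψ-ok {x} x∈ with x⁺ , x≤p ← ∈-range⁻ x∈ =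
      ((d⁺ , d⁺ , x⁺ , ℕ.m<n⇒0<n∸m (s≤s x≤p) ,
        trans (sym (ℕ.*-distribˡ-+ d x _)) (trans (cong (d ℕ.*_) (ℕ.m+[n∸m]≡n (ℕ.m≤n⇒m≤1+n x≤p))) dq≡n)) , refl , refl) , refl

-- For x = y the equation reads (a + b) x = n. The divisor d = a + b fixes x = y = n / d, while a
-- runs freely over 1, ..., d - 1.
∑-x≡y : ∀ n (g : ℕ → ℕ → ℤ) →
  ∑ (filter x≟y? (reps n)) (coeffs g) ≡ ∑ (divisors n) (λ d → ∑ (range (d ∸ 1)) (λ a → g a (d ∸ a)))
∑-x≡y n g = begin
  ∑ (filter x≟y? (reps n)) (coeffs g)
    ≡⟨ ∑-fibres ℕ._≟_ a+b (filter x≟y? (reps n)) (divisors-unique n) (λ {t} → a+b∈divisors t) (coeffs g) ⟩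
  ∑ (divisors n) (λ d → ∑ (filter (λ t → a+b t ℕ.≟ d) (filter x≟y? (reps n))) (coeffs g))
    ≡⟨ ∑-cong∈ (divisors n) fibre ⟩
  ∑ (divisors n) (λ d → ∑ (range (d ∸ 1)) (λ a → g a (d ∸ a))) ∎
  where
  a+b : Quad → ℕ
  a+b (a , b , x , y) = a ℕ.+ b

  factor : ∀ a b x → a ℕ.* x ℕ.+ b ℕ.* x ≡ n → (a ℕ.+ b) ℕ.* x ≡ n
  factor a b x e = trans (ℕ.*-distribʳ-+ x a b) e

  a+b∈divisors : ∀ t → t ∈ filter x≟y? (reps n) → a+b t ∈ divisors n
  a+b∈divisors t@(a , b , x , y) t∈
    with t∈reps , refl ← ∈-filter⁻ x≟y? {xs = reps n} t∈
    with a⁺ , _ , x⁺ , _ , e ← ∈-reps⁻ {n} {t} t∈reps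
    = ∈-divisors⁺ (ℕ.≤-trans a⁺ (ℕ.≤-trans (≤-product′ a x x⁺) (subst (a ℕ.* x ≤_) e (ℕ.m≤m+n (a ℕ.* x) (b ℕ.* x)))))
                  (divides x (sym (trans (ℕ.*-comm x (a ℕ.+ b)) (factor a b x e))))

  fibre : ∀ {d} → d ∈ divisors n →
    ∑ (filter (λ t → a+b t ℕ.≟ d) (filter x≟y? (reps n))) (coeffs g) ≡ ∑ (range (d ∸ 1)) (λ a → g a (d ∸ a))
  fibre {d} d∈ with d⁺ , n⁺ , d∣n ← ∈-divisors⁻ {d} {n} d∈ = begin
    ∑ F (coeffs g)
      ≡⟨ ∑-cong∈ F shape ⟩
    ∑ F (λ t → g (proj₁ t) (d ∸ proj₁ t))
      ≡⟨ ∑-fibre n x≟y? ℕ._≟_ ℕ._≟_ a+b d (range-unique (d ∸ 1)) proj₁ (λ a → a , d ∸ a , q , q) φ-ok ψ-ok (λ a → g a (d ∸ a)) ⟩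
    ∑ (range (d ∸ 1)) (λ a → g a (d ∸ a)) ∎
    where
    q : ℕ
    q = quot n d
    F : List Quad
    F = filter (λ t → a+b t ℕ.≟ d) (filter x≟y? (reps n))
    shape : ∀ {t} → t ∈ F → coeffs g t ≡ g (proj₁ t) (d ∸ proj₁ t)
    shape {a , b , x , y} t∈ with _ , refl ← ∈-filter⁻ (λ t → a+b t ℕ.≟ d) {xs = filter x≟y? (reps n)} t∈
      = cong (g a) (sym (ℕ.m+n∸m≡n a b))
    φ-ok : ∀ t → IsRep n t → proj₁ (proj₂ (proj₂ t)) ≡ proj₂ (proj₂ (proj₂ t)) → a+b t ≡ d → _
    φ-ok (a , b , x , y) (a⁺ , b⁺ , x⁺ , y⁺ , e) refl refl =
      ∈-range⁺ a⁺ (subst (_≤ a ℕ.+ b ∸ 1) (ℕ.m+n∸n≡m a 1) (ℕ.∸-monoˡ-≤ 1 (ℕ.+-monoʳ-≤ a b⁺))) ,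
      cong₂ (λ b x → a , b , x , x) (ℕ.m+n∸m≡n a b) (quot-unique d⁺ (factor a b x e))
    ψ-ok : ∀ {a} → a ∈ range (d ∸ 1) → _
    ψ-ok {a} a∈ with a⁺ , a≤ ← ∈-range⁻ a∈ =
      ((a⁺ , ℕ.m<n⇒0<n∸m a<d , q⁺ , q⁺ , trans (sym (ℕ.*-distribʳ-+ q a (d ∸ a))) (trans (cong (ℕ._* q) (ℕ.m+[n∸m]≡n (ℕ.<⇒≤ a<d))) (quot-* d⁺ d∣n))) ,
       refl , ℕ.m+[n∸m]≡n (ℕ.<⇒≤ a<d)) , refl
      where
      a<d : a < d
      a<d = subst (a <_) (ℕ.m+[n∸m]≡n d⁺) (s≤s a≤)
      q⁺ : 1 ≤ q
      q⁺ = quot-pos n⁺ d⁺ d∣n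

-- Group by m = a x: then a is a divisor of m and b one of n - m, chosen independently. The list
-- `ms` is left open so that both 1, ..., n - 1 and the range 0, ..., n of a Cauchy product qualify;
-- further indices add nothing because `divisors 0` is empty.
∑-convolution : ∀ n (f g : ℕ → ℤ) {ms : List ℕ} → Unique ms → (∀ {m} → m < n → 1 ≤ m → m ∈ ms) →
  ∑ (reps n) (coeffs λ a b → f a * g b) ≡ ∑ ms (λ m → ∑ (divisors m) f * ∑ (divisors (n ∸ m)) g)
∑-convolution n f g {ms} ums ∈ms = begin
  ∑ (reps n) (coeffs λ a b → f a * g b)
    ≡⟨ ∑-fibres ℕ._≟_ ax (reps n) ums (λ {t} t∈ → ax∈ t (∈-reps⁻ {n} {t} t∈)) (coeffs λ a b → f a * g b) ⟩
  ∑ ms (λ m → ∑ (filter (λ t → ax t ℕ.≟ m) (reps n)) (coeffs λ a b → f a * g b))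
    ≡⟨ ∑-cong ms fibre ⟩
  ∑ ms (λ m → ∑ (divisors m) f * ∑ (divisors (n ∸ m)) g) ∎
  where
  ax : Quad → ℕ
  ax (a , b , x , y) = a ℕ.* x

  ax⁺ : ∀ a x → 1 ≤ a → 1 ≤ x → 1 ≤ a ℕ.* x
  ax⁺ a x a⁺ x⁺ = ℕ.≤-trans x⁺ (≤-product a x a⁺)

  ax∈ : ∀ t → IsRep n t → ax t ∈ ms
  ax∈ (a , b , x , y) (a⁺ , b⁺ , x⁺ , y⁺ , e) = ∈ms
    (subst (a ℕ.* x <_) e (ℕ.m<m+n (a ℕ.* x) (ax⁺ b y b⁺ y⁺))) (ax⁺ a x a⁺ x⁺)

  fibre : ∀ m → ∑ (filter (λ t → ax t ℕ.≟ m) (reps n)) (coeffs λ a b → f a * g b) ≡ ∑ (divisors m) f * ∑ (divisors (n ∸ m)) g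
  fibre m = trans
    (∑-bijection _≟⁴_ _≟²_ (Unique.filter⁺ h? (reps-unique n)) (Unique.cartesianProduct⁺ (divisors-unique m) (divisors-unique (n ∸ m)))
      (λ (a , b , x , y) → a , b) (λ (a , b) → a , b , quot m a , quot (n ∸ m) b) φ-ok ψ-ok (λ (a , b) → f a * g b))
    (∑-× (divisors m) (divisors (n ∸ m)) f g)
    where
    h? : Decidable (λ t → ax t ≡ m)
    h? t = ax t ℕ.≟ m
    φ-ok : ∀ {t} → t ∈ filter h? (reps n) → _
    φ-ok {t@(a , b , x , y)} t∈
      with t∈reps , refl ← ∈-filter⁻ h? {xs = reps n} t∈
      with a⁺ , b⁺ , x⁺ , y⁺ , e ← ∈-reps⁻ {n} {t} t∈reps
      = ∈-cartesianProduct⁺ (∈-divisors⁺ (ax⁺ a x a⁺ x⁺) (divides x (ℕ.*-comm a x)))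
                            (∈-divisors⁺ (subst (1 ≤_) by≡ (ax⁺ b y b⁺ y⁺)) (divides y (trans (sym by≡) (ℕ.*-comm b y)))) ,
        cong₂ (λ x y → a , b , x , y) (quot-unique a⁺ refl) (quot-unique b⁺ by≡)
      where
      by≡ : b ℕ.* y ≡ n ∸ a ℕ.* x
      by≡ = trans (sym (ℕ.m+n∸m≡n (a ℕ.* x) (b ℕ.* y))) (cong (_∸ a ℕ.* x) e)
    ψ-ok : ∀ {c} → c ∈ cartesianProduct (divisors m) (divisors (n ∸ m)) → _
    ψ-ok {a , b} c∈
      with a∈ , b∈ ← ∈-cartesianProduct⁻ (divisors m) (divisors (n ∸ m)) c∈
      with a⁺ , m⁺ , a∣m ← ∈-divisors⁻ {a} {m} a∈
      with b⁺ , n∸m⁺ , b∣n∸m ← ∈-divisors⁻ {b} {n ∸ m} b∈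
      -- That `n ∸ m` has a listed divisor forces it to be positive, hence m < n and the truncated
      -- subtraction is exact.
      = ∈-filter⁺ h? (∈-reps⁺ {n} (a⁺ , b⁺ , quot-pos m⁺ a⁺ a∣m , quot-pos n∸m⁺ b⁺ b∣n∸m ,
          trans (cong₂ ℕ._+_ (quot-* a⁺ a∣m) (quot-* b⁺ b∣n∸m)) (ℕ.m+[n∸m]≡n {m} {n} (ℕ.<⇒≤ (ℕ.m∸n≢0⇒n<m {n} {m} (ℕ.>⇒≢ n∸m⁺))))))
          (quot-* a⁺ a∣m) ,
        refl

-- Group by (a , b). Since a + b ≤ a x + b y = n and gcd a b divides a x + b y, every representation
-- with b < a lies over a listed pair; the inner sum counts its (x , y).
∑-coefficientPairs : ∀ n (f : ℕ → ℕ → ℤ) → ∑ (filter b<a? (reps n)) (coeffs f) ≡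
  ∑ (coefficientPairs n) (λ (a , b) → f a b * ∑ (solutions a b n) (λ _ → 1ℤ))
∑-coefficientPairs n f = begin
  ∑ (filter b<a? (reps n)) (coeffs f)
    ≡⟨ ∑-fibres _≟²_ ab (filter b<a? (reps n)) (Unique.filter⁺ pair? (Unique.cartesianProduct⁺ (range-unique n) (range-unique n))) (λ {t} → ab∈ t) (coeffs f) ⟩
  ∑ (coefficientPairs n) (λ c → ∑ (filter (λ t → ab t ≟² c) (filter b<a? (reps n))) (coeffs f))
    ≡⟨ ∑-cong∈ (coefficientPairs n) fibre ⟩
  ∑ (coefficientPairs n) (λ (a , b) → f a b * ∑ (solutions a b n) (λ _ → 1ℤ)) ∎
  where
  ab : Quad → ℕ × ℕ
  ab (a , b , x , y) = a , b

  pair? : Decidable {A = ℕ × ℕ} λ (a , b) → b < a × a ℕ.+ b ≤ n × gcd a b ∣ n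
  pair? (a , b) = (b ℕ.<? a) ×-dec (a ℕ.+ b ℕ.≤? n) ×-dec (gcd a b ∣? n)

  ab∈ : ∀ t → t ∈ filter b<a? (reps n) → ab t ∈ coefficientPairs n
  ab∈ t@(a , b , x , y) t∈
    with t∈reps , b<a ← ∈-filter⁻ b<a? {xs = reps n} t∈
    with a⁺ , b⁺ , x⁺ , y⁺ , e ← ∈-reps⁻ {n} {t} t∈reps
    = ∈-filter⁺ pair? (∈-cartesianProduct⁺ (∈-range⁺ a⁺ (ℕ.≤-trans (ℕ.m≤m+n a b) a+b≤n)) (∈-range⁺ b⁺ (ℕ.≤-trans (ℕ.m≤n+m b a) a+b≤n)))
        (b<a , a+b≤n , subst (gcd a b ∣_) e (∣m∣n⇒∣m+n (∣m⇒∣m*n x (gcd[m,n]∣m a b)) (∣m⇒∣m*n y (gcd[m,n]∣n a b))))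
    where
    a+b≤n : a ℕ.+ b ≤ n
    a+b≤n = subst (a ℕ.+ b ≤_) e (ℕ.+-mono-≤ (≤-product′ a x x⁺) (≤-product′ b y y⁺))

  fibre : ∀ {c} → c ∈ coefficientPairs n → ∑ (filter (λ t → ab t ≟² c) (filter b<a? (reps n))) (coeffs f)
        ≡ f (proj₁ c) (proj₂ c) * ∑ (solutions (proj₁ c) (proj₂ c) n) (λ _ → 1ℤ)
  fibre {c@(a , b)} c∈ with c∈ranges , b<a , _ , _ ← ∈-filter⁻ pair? {xs = cartesianProduct (range n) (range n)} c∈
                       with a∈ , b∈ ← ∈-cartesianProduct⁻ (range n) (range n) c∈ranges = begin
    ∑ F (coeffs f)
      ≡⟨ ∑-cong∈ F constant ⟩
    ∑ F (λ _ → f a b * 1ℤ)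
      ≡⟨ ∑-fibre n b<a? _≟²_ _≟²_ ab c (Unique.filter⁺ sol? (Unique.cartesianProduct⁺ (range-unique n) (range-unique n)))
           (λ (a , b , x , y) → x , y) (λ (x , y) → a , b , x , y) φ-ok ψ-ok (λ _ → f a b * 1ℤ) ⟩
    ∑ (solutions a b n) (λ _ → f a b * 1ℤ)
      ≡⟨ ∑-*ˡ (solutions a b n) (f a b) (λ _ → 1ℤ) ⟩
    f a b * ∑ (solutions a b n) (λ _ → 1ℤ) ∎
    where
    F : List Quad
    F = filter (λ t → ab t ≟² c) (filter b<a? (reps n))
    sol? : Decidable {A = ℕ × ℕ} λ (x , y) → a ℕ.* x ℕ.+ b ℕ.* y ≡ n
    sol? (x , y) = a ℕ.* x ℕ.+ b ℕ.* y ℕ.≟ n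
    constant : ∀ {t} → t ∈ F → coeffs f t ≡ f a b * 1ℤ
    constant {_ , _ , x , y} t∈ with _ , refl ← ∈-filter⁻ (λ t → ab t ≟² c) {xs = filter b<a? (reps n)} t∈
      = sym (ℤ.*-identityʳ (f a b))
    φ-ok : ∀ t → IsRep n t → proj₁ (proj₂ t) < proj₁ t → ab t ≡ c → _
    φ-ok (_ , _ , x , y) (_ , _ , x⁺ , y⁺ , e) _ refl =
      ∈-filter⁺ sol? (∈-cartesianProduct⁺
        (∈-range⁺ x⁺ (ℕ.≤-trans (≤-product a x (proj₁ (∈-range⁻ a∈))) (subst (a ℕ.* x ≤_) e (ℕ.m≤m+n (a ℕ.* x) (b ℕ.* y)))))
        (∈-range⁺ y⁺ (ℕ.≤-trans (≤-product b y (proj₁ (∈-range⁻ b∈))) (subst (b ℕ.* y ≤_) e (ℕ.m≤n+m (b ℕ.* y) (a ℕ.* x)))))) e ,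
      refl
    ψ-ok : ∀ {s} → s ∈ solutions a b n → _
    ψ-ok {x , y} s∈ with s∈ranges , e ← ∈-filter⁻ sol? {xs = cartesianProduct (range n) (range n)} s∈
                    with x∈ , y∈ ← ∈-cartesianProduct⁻ (range n) (range n) s∈ranges
      = ((proj₁ (∈-range⁻ a∈) , proj₁ (∈-range⁻ b∈) , proj₁ (∈-range⁻ x∈) , proj₁ (∈-range⁻ y∈) , e) , b<a , refl) , refl

-- Powers, telescoping, and the identity attached to an even polynomial

^-ℕ : ∀ d r → + (d ℕ.^ r) ≡ (+ d) Pℤ.^ r
^-ℕ d zero    = refl
^-ℕ d (suc r) = trans (ℤ.pos-* d (d ℕ.^ r)) (cong (+ d *_) (^-ℕ d r))

σ-∑ : ∀ r n → + σ r n ≡ ∑ (divisors n) (λ d → (+ d) Pℤ.^ r)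
σ-∑ r n = go (divisors n)
  where
  go : ∀ ds → + ℕ.sum (map (ℕ._^ r) ds) ≡ ∑ ds (λ d → (+ d) Pℤ.^ r)
  go []       = refl
  go (d ∷ ds) = cong₂ _+_ (^-ℕ d r) (go ds)

∑-applyUpTo-telescope : ∀ (g : ℕ → ℕ) (h K : ℕ → ℤ) m → (∀ i → h (g i) ≡ K (suc i) - K i) →
  ∑ (applyUpTo g m) h ≡ K m - K 0
∑-applyUpTo-telescope g h K zero    step = sym (ℤ.+-inverseʳ (K 0))
∑-applyUpTo-telescope g h K (suc m) step =
  trans (cong₂ _+_ (step 0) (∑-applyUpTo-telescope (g ∘ suc) h (K ∘ suc) m (step ∘ suc))) (telescope (K 1) (K 0) (K (suc m)))
  where
  telescope : ∀ i j k → (i - j) + (k - i) ≡ k - j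
  telescope = solve 3 (λ i j k → (i :- j) :+ (k :- i) := k :- j) refl

∑-range-telescope : ∀ (K : ℕ → ℤ) m → ∑ (range m) (λ i → K (suc i) - K i) ≡ K (suc m) - K 1
∑-range-telescope K m = trans (∑-map suc (upTo m) _)
  (∑-applyUpTo-telescope id (λ i → K (suc (suc i)) - K (suc i)) (K ∘ suc) m (λ _ → refl))

pos-∸ : ∀ {a d} → a ≤ d → + (d ∸ a) ≡ + d - + a
pos-∸ {a} {d} a≤d = trans (sym (ℤ.⊖-≥ a≤d)) (sym (ℤ.m-n≡m⊖n d a))

-- For b = a + c both symmetrised summands consist of the same six values of `F`. Five agree
-- literally; the sixth is F(-c , a) against F(c , -a), and here evenness enters.
∑-reps-even : ∀ (F : ℤ → ℤ → ℤ) → (∀ x y → F (- x) (- y) ≡ F x y) → ∀ n →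
  let g₁′ = λ a b → Pℤ.g₁ F (+ a) (+ b) ; g₂′ = λ a b → Pℤ.g₂ F (+ a) (+ b) in
  ∑ (reps n) (coeffs λ a b → g₁′ a b - g₂′ a b)
    ≡ ∑ (filter a≟b? (reps n)) (coeffs g₁′) - ∑ (filter x≟y? (reps n)) (coeffs g₂′)
∑-reps-even F even n = trans (∑-- (reps n) _ _) (∑-descent n _ _ λ a c → agree (+ a) (+ c))
  where
  agree : ∀ a c → Pℤ.g₁ F a (a + c) + Pℤ.g₁ F (a + c) a ≡ Pℤ.g₂ F a c + Pℤ.g₂ F c a
  agree a c = begin
    Pℤ.g₁ F a (a + c) + Pℤ.g₁ F (a + c) a
      ≡⟨ cong₂ (λ u v → F a (a + c) + F a u + F v (a + c) + (F (a + c) a + F (a + c) v + F u a))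
               (solve 2 (λ a c → a :- (a :+ c) := :- c) refl a c) (solve 2 (λ a c → (a :+ c) :- a := c) refl a c) ⟩
    F a (a + c) + F a (- c) + F c (a + c) + (F (a + c) a + F (a + c) c + F (- c) a)
      ≡⟨ cong (λ v → F a (a + c) + F a (- c) + F c (a + c) + (F (a + c) a + F (a + c) c + v))
           (trans (sym (even (- c) a)) (cong (λ u → F u (- a)) (ℤ.neg-involutive c))) ⟩
    F a (a + c) + F a (- c) + F c (a + c) + (F (a + c) a + F (a + c) c + F c (- a))
      ≡⟨ solve 6 (λ p q r s t u → p :+ q :+ r :+ (s :+ t :+ u) := q :+ p :+ t :+ (u :+ r :+ s)) refl
           (F a (a + c)) (F a (- c)) (F c (a + c)) (F (a + c) a) (F (a + c) c) (F c (- a)) ⟩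
    F a (- c) + F a (a + c) + F (a + c) c + (F c (- a) + F c (a + c) + F (a + c) a)
      ≡⟨ cong (λ s → F a (- c) + F a (a + c) + F (a + c) c + (F c (- a) + F c s + F s a)) (ℤ.+-comm a c) ⟩
    Pℤ.g₂ F a c + Pℤ.g₂ F c a ∎

-- The scalar c is carried along because Faulhaber's formula has denominators: the sum over the
-- diagonal x = y equals (K d d - K d 1) / c for each divisor d.
∑-reps-polynomial : ∀ (F K : ℤ → ℤ → ℤ) (c : ℤ) (k : ℕ → ℤ) n →
  (∀ x y → F (- x) (- y) ≡ F x y) →
  (∀ a d → c * Pℤ.g₂ F a (d - a) ≡ K d (1ℤ + a) - K d a) →
  (∀ d p → d ℕ.* suc p ≡ n → c * (+ p * Pℤ.g₁ F (+ d) (+ d)) - (K (+ d) (+ d) - K (+ d) 1ℤ) ≡ k d) →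
  c * ∑ (reps n) (coeffs λ a b → Pℤ.g₁ F (+ a) (+ b) - Pℤ.g₂ F (+ a) (+ b)) ≡ ∑ (divisors n) k
∑-reps-polynomial F K c k n even step boundary = begin
  c * ∑ (reps n) (coeffs λ a b → g₁′ a b - g₂′ a b)
    ≡⟨ cong (c *_) (∑-reps-even F even n) ⟩
  c * (∑ (filter a≟b? (reps n)) (coeffs g₁′) - ∑ (filter x≟y? (reps n)) (coeffs g₂′))
    ≡⟨ cong (c *_) (cong₂ _-_ (∑-a≡b n g₁′ k₁ k₁-≡) (∑-x≡y n g₂′)) ⟩
  c * (∑ (divisors n) k₁ - ∑ (divisors n) k₂)
    ≡⟨ cong (c *_) (sym (∑-- (divisors n) k₁ k₂)) ⟩
  c * ∑ (divisors n) (λ d → k₁ d - k₂ d)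
    ≡⟨ sym (∑-*ˡ (divisors n) c _) ⟩
  ∑ (divisors n) (λ d → c * (k₁ d - k₂ d))
    ≡⟨ ∑-cong∈ (divisors n) divisor ⟩
  ∑ (divisors n) k ∎
  where
  g₁′ g₂′ : ℕ → ℕ → ℤ
  g₁′ a b = Pℤ.g₁ F (+ a) (+ b)
  g₂′ a b = Pℤ.g₂ F (+ a) (+ b)
  k₁ k₂ : ℕ → ℤ
  -- For n = d (1 + p) the factor is p.
  k₁ d = + (quot n d ∸ 1) * g₁′ d d
  k₂ d = ∑ (range (d ∸ 1)) (λ a → g₂′ a (d ∸ a))
  k₁-≡ : ∀ d p → 1 ≤ d → d ℕ.* suc p ≡ n → + p * g₁′ d d ≡ k₁ d
  k₁-≡ d p d⁺ eq = cong (λ q → + (q ∸ 1) * g₁′ d d) (sym (quot-unique d⁺ eq))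
  k₂-≡ : ∀ d → 1 ≤ d → c * k₂ d ≡ K (+ d) (+ d) - K (+ d) 1ℤ
  k₂-≡ (suc d) _ = begin
    c * ∑ (range d) (λ a → g₂′ a (suc d ∸ a))
      ≡⟨ sym (∑-*ˡ (range d) c _) ⟩
    ∑ (range d) (λ a → c * g₂′ a (suc d ∸ a))
      ≡⟨ ∑-cong∈ (range d) (λ {a} a∈ → trans (cong (λ b → c * Pℤ.g₂ F (+ a) b) (pos-∸ (ℕ.m≤n⇒m≤1+n (proj₂ (∈-range⁻ a∈))))) (step (+ a) (+ suc d))) ⟩
    ∑ (range d) (λ a → K (+ suc d) (+ suc a) - K (+ suc d) (+ a))
      ≡⟨ ∑-range-telescope (λ a → K (+ suc d) (+ a)) d ⟩
    K (+ suc d) (+ suc d) - K (+ suc d) 1ℤ ∎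
  divisor : ∀ {d} → d ∈ divisors n → c * (k₁ d - k₂ d) ≡ k d
  divisor {d} d∈ with d⁺ , n⁺ , d∣n ← ∈-divisors⁻ {d} {n} d∈ with quot n d | quot-* {d} {n} d⁺ d∣n | quot-pos {d} {n} n⁺ d⁺ d∣n
  ... | suc p | eq | _ = begin
    c * (+ p * g₁′ d d - k₂ d)
      ≡⟨ solve 3 (λ c u v → c :* (u :- v) := c :* u :- c :* v) refl c (+ p * g₁′ d d) (k₂ d) ⟩
    c * (+ p * g₁′ d d) - c * k₂ d
      ≡⟨ cong (λ s → c * (+ p * g₁′ d d) - s) (k₂-≡ d d⁺) ⟩
    c * (+ p * g₁′ d d) - (K (+ d) (+ d) - K (+ d) 1ℤ)
      ≡⟨ boundary d p eq ⟩
    k d ∎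

-- Formal power series

infixl 6 _⊕_
infixl 7 _⊙_

_⊕_ : Series → Series → Series
(f ⊕ g) n = f n + g n

_⊙_ : ℤ → Series → Series
(c ⊙ f) n = c * f n

tail : Series → Series
tail f n = f (suc n)

⊛-cong : ∀ {f f′ g g′ : Series} n → (∀ i → i ≤ n → f i ≡ f′ i) → (∀ i → i ≤ n → g i ≡ g′ i) → (f ⊛ g) n ≡ (f′ ⊛ g′) n
⊛-cong n f≡ g≡ = ∑-cong∈ (upTo (suc n)) λ {i} i∈ → cong₂ _*_ (f≡ i (ℕ.≤-pred (∈-upTo⁻ i∈))) (g≡ (n ∸ i) (ℕ.m∸n≤m n i))

⊛-congˡ : ∀ {f f′ : Series} (g : Series) → f ≗ f′ → f ⊛ g ≗ f′ ⊛ g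
⊛-congˡ {f} {f′} g f≡ n = ⊛-cong {f} {f′} {g} {g} n (λ i _ → f≡ i) (λ _ _ → refl)

⊛-congʳ : ∀ (f : Series) {g g′ : Series} → g ≗ g′ → f ⊛ g ≗ f ⊛ g′
⊛-congʳ f {g} {g′} g≡ n = ⊛-cong {f} {f} {g} {g′} n (λ _ _ → refl) (λ i _ → g≡ i)

⊛-suc : ∀ f g n → (f ⊛ g) (suc n) ≡ f 0 * g (suc n) + (tail f ⊛ g) n
⊛-suc f g n = +-congˡ (f 0 * g (suc n))
  (trans (cong (λ is → ∑ is (λ i → f i * g (suc n ∸ i))) (sym (map-applyUpTo id suc (suc n))))
         (∑-map suc (upTo (suc n)) (λ i → f i * g (suc n ∸ i))))

⊛-comm : ∀ f g → f ⊛ g ≗ g ⊛ f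
⊛-comm f g n = trans
  (∑-cong∈ (upTo (suc n)) λ {i} i∈ → trans (ℤ.*-comm (f i) (g (n ∸ i))) (cong (λ j → g (n ∸ i) * f j) (sym (reflect i∈))))
  (∑-bijection ℕ._≟_ ℕ._≟_ (Unique.upTo⁺ (suc n)) (Unique.upTo⁺ (suc n)) (n ∸_) (n ∸_) ok ok (λ j → g j * f (n ∸ j)))
  where
  reflect : ∀ {i} → i ∈ upTo (suc n) → n ∸ (n ∸ i) ≡ i
  reflect i∈ = ℕ.m∸[m∸n]≡n (ℕ.≤-pred (∈-upTo⁻ i∈))
  ok : ∀ {i} → i ∈ upTo (suc n) → n ∸ i ∈ upTo (suc n) × n ∸ (n ∸ i) ≡ i
  ok {i} i∈ = ∈-upTo⁺ (s≤s (ℕ.m∸n≤m n i)) , reflect i∈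

⊛-distribʳ-⊕ : ∀ f g h → (f ⊕ g) ⊛ h ≗ (f ⊛ h) ⊕ (g ⊛ h)
⊛-distribʳ-⊕ f g h n = trans (∑-cong (upTo (suc n)) λ i → ℤ.*-distribʳ-+ (h (n ∸ i)) (f i) (g i)) (∑-+ (upTo (suc n)) (λ i → f i * h (n ∸ i)) (λ i → g i * h (n ∸ i)))

⊛-distribˡ-⊕ : ∀ f g h → f ⊛ (g ⊕ h) ≗ (f ⊛ g) ⊕ (f ⊛ h)
⊛-distribˡ-⊕ f g h n = trans (⊛-comm f (g ⊕ h) n) (trans (⊛-distribʳ-⊕ g h f n) (cong₂ _+_ (⊛-comm g f n) (⊛-comm h f n)))

⊙-⊛ : ∀ c f g → (c ⊙ f) ⊛ g ≗ c ⊙ (f ⊛ g)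
⊙-⊛ c f g n = trans (∑-cong (upTo (suc n)) λ i → ℤ.*-assoc c (f i) (g (n ∸ i))) (∑-*ˡ (upTo (suc n)) c _)

⊛-⊙ : ∀ f c g → f ⊛ (c ⊙ g) ≗ c ⊙ (f ⊛ g)
⊛-⊙ f c g n = trans (⊛-comm f (c ⊙ g) n) (trans (⊙-⊛ c g f n) (cong (c *_) (⊛-comm g f n)))

-- Induction on the index instead of a rearrangement of triple sums: `tail (f ⊛ g)` is f 0 ·
-- `tail g` plus `tail f ⊛ g`, so coefficient n + 1 reduces to coefficient n for `tail f`, g, h.
⊛-assoc : ∀ f g h → (f ⊛ g) ⊛ h ≗ f ⊛ (g ⊛ h)
⊛-assoc f g h zero = solve 3 (λ a b c → (a :* b :+ con 0ℤ) :* c :+ con 0ℤ := a :* (b :* c :+ con 0ℤ) :+ con 0ℤ) refl (f 0) (g 0) (h 0)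
⊛-assoc f g h (suc n) = begin
  ((f ⊛ g) ⊛ h) (suc n)
    ≡⟨ ⊛-suc (f ⊛ g) h n ⟩
  (f ⊛ g) 0 * h (suc n) + (tail (f ⊛ g) ⊛ h) n
    ≡⟨ +-congˡ ((f ⊛ g) 0 * h (suc n)) (trans (⊛-congˡ h (⊛-suc f g) n) (⊛-distribʳ-⊕ (f 0 ⊙ tail g) (tail f ⊛ g) h n)) ⟩
  (f ⊛ g) 0 * h (suc n) + (((f 0 ⊙ tail g) ⊛ h) n + ((tail f ⊛ g) ⊛ h) n)
    ≡⟨ +-congˡ ((f ⊛ g) 0 * h (suc n)) (cong₂ _+_ (⊙-⊛ (f 0) (tail g) h n) (⊛-assoc (tail f) g h n)) ⟩
  (f ⊛ g) 0 * h (suc n) + (f 0 * (tail g ⊛ h) n + (tail f ⊛ (g ⊛ h)) n)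
    ≡⟨ solve 5 (λ a b c d e → (a :* b :+ con 0ℤ) :* c :+ (a :* d :+ e) := a :* (b :* c :+ d) :+ e) refl
         (f 0) (g 0) (h (suc n)) ((tail g ⊛ h) n) ((tail f ⊛ (g ⊛ h)) n) ⟩
  f 0 * (g 0 * h (suc n) + (tail g ⊛ h) n) + (tail f ⊛ (g ⊛ h)) n
    ≡⟨ cong (λ s → f 0 * s + (tail f ⊛ (g ⊛ h)) n) (sym (⊛-suc g h n)) ⟩
  f 0 * (g ⊛ h) (suc n) + (tail f ⊛ (g ⊛ h)) n
    ≡⟨ sym (⊛-suc f (g ⊛ h) n) ⟩
  (f ⊛ (g ⊛ h)) (suc n) ∎

⊛-distribʳ-⊖ : ∀ f g h → (f ⊖ g) ⊛ h ≗ (f ⊛ h) ⊖ (g ⊛ h)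
⊛-distribʳ-⊖ f g h n = trans
  (∑-cong (upTo (suc n)) λ i → distrib (f i) (g i) (h (n ∸ i)))
  (∑-- (upTo (suc n)) (λ i → f i * h (n ∸ i)) (λ i → g i * h (n ∸ i)))
  where
  distrib : ∀ i j k → (i - j) * k ≡ i * k - j * k
  distrib = solve 3 (λ i j k → (i :- j) :* k := i :* k :- j :* k) refl

⊛-distribˡ-⊖ : ∀ f g h → f ⊛ (g ⊖ h) ≗ (f ⊛ g) ⊖ (f ⊛ h)
⊛-distribˡ-⊖ f g h n = trans (⊛-comm f (g ⊖ h) n) (trans (⊛-distribʳ-⊖ g h f n) (cong₂ _-_ (⊛-comm g f n) (⊛-comm h f n)))

⊛-zeroˡ : ∀ f → (λ _ → 0ℤ) ⊛ f ≗ λ _ → 0ℤ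
⊛-zeroˡ f n = trans (∑-cong (upTo (suc n)) λ i → ℤ.*-zeroˡ (f (n ∸ i))) (∑-0 (upTo (suc n)))

⊛-identityˡ : ∀ f → 𝟙 ⊛ f ≗ f
⊛-identityˡ f n = ⊛-low {𝟙} {suc n} f n (λ _ _ → refl) ℕ.≤-refl

⊛-identityʳ : ∀ f → f ⊛ 𝟙 ≗ f
⊛-identityʳ f n = trans (⊛-comm f 𝟙 n) (⊛-identityˡ f n)

∂ : Series → Series
∂ f n = + n * f n

∂-⊛ : ∀ f g → ∂ (f ⊛ g) ≗ (∂ f ⊛ g) ⊕ (f ⊛ ∂ g)
∂-⊛ f g n = begin
  + n * (f ⊛ g) n
    ≡⟨ sym (∑-*ˡ (upTo (suc n)) (+ n) _) ⟩
  ∑ (upTo (suc n)) (λ i → + n * (f i * g (n ∸ i)))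
    ≡⟨ ∑-cong∈ (upTo (suc n)) leibniz ⟩
  ∑ (upTo (suc n)) (λ i → ∂ f i * g (n ∸ i) + f i * ∂ g (n ∸ i))
    ≡⟨ ∑-+ (upTo (suc n)) (λ i → ∂ f i * g (n ∸ i)) (λ i → f i * ∂ g (n ∸ i)) ⟩
  (∂ f ⊛ g) n + (f ⊛ ∂ g) n ∎
  where
  leibniz : ∀ {i} → i ∈ upTo (suc n) → + n * (f i * g (n ∸ i)) ≡ ∂ f i * g (n ∸ i) + f i * ∂ g (n ∸ i)
  leibniz {i} i∈ = trans
    (cong (λ m → + m * (f i * g (n ∸ i))) (sym (ℕ.m+[n∸m]≡n (ℕ.≤-pred (∈-upTo⁻ i∈)))))
    (solve 4 (λ i j a b → (i :+ j) :* (a :* b) := i :* a :* b :+ a :* (j :* b)) refl (+ i) (+ (n ∸ i)) (f i) (g (n ∸ i)))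

∂-⊖ : ∀ f g → ∂ (f ⊖ g) ≗ ∂ f ⊖ ∂ g
∂-⊖ f g n = distrib (+ n) (f n) (g n)
  where
  distrib : ∀ i j k → i * (j - k) ≡ i * j - i * k
  distrib = solve 3 (λ i j k → i :* (j :- k) := i :* j :- i :* k) refl

infix 4 ∂log_≗_
-- Written without dividing by f, so that it applies to q, which has no inverse, and is linear in f.
∂log_≗_ : Series → Series → Set
∂log f ≗ ℓ = ∂ f ≗ ℓ ⊛ f

∂log-⊛ : ∀ {f g ℓ m} → ∂log f ≗ ℓ → ∂log g ≗ m → ∂log (f ⊛ g) ≗ ℓ ⊕ m
∂log-⊛ {f} {g} {ℓ} {m} ∂f ∂g n = begin
  ∂ (f ⊛ g) n
    ≡⟨ ∂-⊛ f g n ⟩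
  (∂ f ⊛ g) n + (f ⊛ ∂ g) n
    ≡⟨ cong₂ _+_ (trans (⊛-congˡ g ∂f n) (⊛-assoc ℓ f g n)) (trans (⊛-congʳ f ∂g n) (exchange n)) ⟩
  (ℓ ⊛ (f ⊛ g)) n + (m ⊛ (f ⊛ g)) n
    ≡⟨ sym (⊛-distribʳ-⊕ ℓ m (f ⊛ g) n) ⟩
  ((ℓ ⊕ m) ⊛ (f ⊛ g)) n ∎
  where
  exchange : f ⊛ (m ⊛ g) ≗ m ⊛ (f ⊛ g)
  exchange n = begin
    (f ⊛ (m ⊛ g)) n  ≡⟨ sym (⊛-assoc f m g n) ⟩
    ((f ⊛ m) ⊛ g) n  ≡⟨ ⊛-congˡ g (⊛-comm f m) n ⟩
    ((m ⊛ f) ⊛ g) n  ≡⟨ ⊛-assoc m f g n ⟩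
    (m ⊛ (f ⊛ g)) n  ∎

∂log-cong : ∀ {f ℓ m} → ∂log f ≗ ℓ → ℓ ≗ m → ∂log f ≗ m
∂log-cong {f} ∂f ℓ≗m n = trans (∂f n) (⊛-congˡ f ℓ≗m n)

∂log-𝟙 : ∂log 𝟙 ≗ λ _ → 0ℤ
∂log-𝟙 zero    = refl
∂log-𝟙 (suc n) = trans (ℤ.*-zeroʳ (+ suc n)) (sym (⊛-zeroˡ 𝟙 (suc n)))

∂log-⊛^ : ∀ {f ℓ} k → ∂log f ≗ ℓ → ∂log (f ⊛^ k) ≗ + k ⊙ ℓ
∂log-⊛^ {f} {ℓ} zero    ∂f = ∂log-cong {𝟙} ∂log-𝟙 (λ n → sym (ℤ.*-zeroˡ (ℓ n)))
∂log-⊛^ {f} {ℓ} (suc k) ∂f = ∂log-cong {f ⊛ (f ⊛^ k)} (∂log-⊛ {f} {f ⊛^ k} {ℓ} {+ k ⊙ ℓ} ∂f (∂log-⊛^ {f} {ℓ} k ∂f)) (λ n → sym (ℤ.suc-* (+ k) (ℓ n)))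

-- A solution of ∂f = ℓ f with ℓ(0) = 1 satisfies (n − 1) f(n) = Σ_{i ≥ 1} ℓ(i) f(n − i).
∂log-vanish : ∀ {f ℓ} → ∂log f ≗ ℓ → ℓ 0 ≡ 1ℤ → f 0 ≡ 0ℤ → f 1 ≡ 0ℤ → ∀ n → f n ≡ 0ℤ
∂log-vanish {f} {ℓ} ∂f ℓ0 f0 f1 = <-rec _ go
  where
  go : ∀ n → (∀ {m} → m < n → f m ≡ 0ℤ) → f n ≡ 0ℤ
  go zero          ih = f0
  go (suc zero)    ih = f1
  go (suc (suc n)) ih = ℤ.*-cancelˡ-≡ +[1+ n ] (f (2 ℕ.+ n)) 0ℤ (trans cancelled (sym (ℤ.*-zeroʳ +[1+ n ])))
    where
    N : ℕ
    N = 2 ℕ.+ n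
    rest : (tail ℓ ⊛ f) (suc n) ≡ 0ℤ
    rest = trans (⊛-cong {tail ℓ} {tail ℓ} {f} {λ _ → 0ℤ} (suc n) (λ _ _ → refl) (λ i i≤ → ih (s≤s i≤)))
                 (trans (⊛-comm (tail ℓ) (λ _ → 0ℤ) (suc n)) (⊛-zeroˡ (tail ℓ) (suc n)))
    recurrence : + N * f N ≡ f N
    recurrence = begin
      + N * f N                                ≡⟨ ∂f N ⟩
      (ℓ ⊛ f) N                                ≡⟨ ⊛-suc ℓ f (suc n) ⟩
      ℓ 0 * f N + (tail ℓ ⊛ f) (suc n)         ≡⟨ cong₂ (λ u v → u * f N + v) ℓ0 rest ⟩
      1ℤ * f N + 0ℤ                            ≡⟨ trans (ℤ.+-identityʳ _) (ℤ.*-identityˡ (f N)) ⟩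
      f N                                      ∎
    cancelled : +[1+ n ] * f N ≡ 0ℤ
    cancelled = begin
      +[1+ n ] * f N                ≡⟨ solve 2 (λ u v → u :* v := (con 1ℤ :+ u) :* v :- v) refl +[1+ n ] (f N) ⟩
      + N * f N - f N               ≡⟨ cong (λ u → u - f N) recurrence ⟩
      f N - f N                     ≡⟨ ℤ.+-inverseʳ (f N) ⟩
      0ℤ                            ∎

-- Convolutions of divisor functions

-- The constant coefficient is 0, as `divisors 0` is empty; so the end terms of `𝝈 r ⊛ 𝝈 s` vanish
-- and an Eisenstein series has constant coefficient 1.
𝝈 : ℕ → Series
𝝈 r n = + σ r n

∑-reps-monomial : ∀ r s n → ∑ (reps n) (coeffs λ a b → (+ a) Pℤ.^ r * (+ b) Pℤ.^ s) ≡ (𝝈 r ⊛ 𝝈 s) n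
∑-reps-monomial r s n = trans
  (∑-convolution n (λ a → (+ a) Pℤ.^ r) (λ b → (+ b) Pℤ.^ s) (Unique.upTo⁺ (suc n)) (λ m<n _ → ∈-upTo⁺ (ℕ.m≤n⇒m≤1+n m<n)))
  (∑-cong (upTo (suc n)) λ m → sym (cong₂ _*_ (σ-∑ r m) (σ-∑ s (n ∸ m))))

∑-reps-sorted : ∀ r s n → ∑ (reps n) (coeffs λ a b → (+ a) Pℤ.^ r * (+ b) Pℤ.^ s) ≡ (𝝈 (r ⊓ s) ⊛ 𝝈 (r ⊔ s)) n
∑-reps-sorted r s n with ℕ.≤-total r s
... | inj₁ r≤s rewrite ℕ.m≤n⇒m⊓n≡m r≤s | ℕ.m≤n⇒m⊔n≡n r≤s = ∑-reps-monomial r s n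
... | inj₂ s≤r rewrite ℕ.m≥n⇒m⊓n≡n s≤r | ℕ.m≥n⇒m⊔n≡m s≤r = trans (∑-reps-monomial r s n) (⊛-comm (𝝈 r) (𝝈 s) n)

𝝈⊛𝝈 : ℕ → ℕ → ℕ → ℤ
𝝈⊛𝝈 n r s = (𝝈 r ⊛ 𝝈 s) n

module At (n : ℕ) = Pℤ.Relations (𝝈⊛𝝈 n) (λ r → 𝝈 r n)

∑-reps-monomials : ∀ ms n → ∑ (reps n) (coeffs λ a b → Pℤ.monomials ms (+ a) (+ b)) ≡ At.interior-sum n ms
∑-reps-monomials []                 n = ∑-0 (reps n)
∑-reps-monomials ((k , r , s) ∷ ms) n = trans
  (∑-+ (reps n) (coeffs λ a b → k * ((+ a) Pℤ.^ r * (+ b) Pℤ.^ s)) (coeffs λ a b → Pℤ.monomials ms (+ a) (+ b)))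
  (cong₂ _+_ (trans (∑-*ˡ (reps n) k (coeffs λ a b → (+ a) Pℤ.^ r * (+ b) Pℤ.^ s)) (cong (k *_) (∑-reps-sorted r s n))) (∑-reps-monomials ms n))

∑-divisors-powers : ∀ ps n → ∑ (divisors n) (λ d → Pℤ.powers ps (+ d)) ≡ At.boundary-sum n ps
∑-divisors-powers []             n = ∑-0 (divisors n)
∑-divisors-powers ((k , r) ∷ ps) n = trans
  (∑-+ (divisors n) (λ d → k * (+ d) Pℤ.^ r) (λ d → Pℤ.powers ps (+ d)))
  (cong₂ _+_ (trans (∑-*ˡ (divisors n) k (λ d → (+ d) Pℤ.^ r)) (cong (k *_) (sym (σ-∑ r n)))) (∑-divisors-powers ps n))

-- `ps` depends on n because a = b contributes p = n / d - 1 times a multiple of a power of d, and p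
-- d^(r+1) = n d^r - d^(r+1). These terms n σ_r(n) become the derivatives of E₄ and E₆. They are
-- absent for `F₃₃` and `F₃₇`, where `g₁ F d d` is 0.
𝝈-relation : ∀ (F K : ℤ → ℤ → ℤ) c ms ps →
  Pℤ.Evenness F → Pℤ.Antidifference F K c → Pℤ.Interior F ms → Pℤ.Boundary F K c ps →
  ∀ n → c * At.interior-sum n ms ≡ At.boundary-sum n (ps (+ n))
𝝈-relation F K c ms ps even antidifference interior boundary n = begin
  c * At.interior-sum n ms
    ≡⟨ cong (c *_) (sym (trans (∑-cong (reps n) λ (a , b , _) → interior (+ a) (+ b)) (∑-reps-monomials ms n))) ⟩
  c * ∑ (reps n) (coeffs λ a b → Pℤ.g₁ F (+ a) (+ b) - Pℤ.g₂ F (+ a) (+ b))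
    ≡⟨ ∑-reps-polynomial F K c (λ d → Pℤ.powers (ps (+ n)) (+ d)) n even antidifference
         (λ d p dq≡n → trans (boundary (+ d) (+ p)) (cong (λ m → Pℤ.powers (ps m) (+ d)) (trans (sym (ℤ.pos-* d (suc p))) (cong +_ dq≡n)))) ⟩
  ∑ (divisors n) (λ d → Pℤ.powers (ps (+ n)) (+ d))
    ≡⟨ ∑-divisors-powers (ps (+ n)) n ⟩
  At.boundary-sum n (ps (+ n)) ∎

module _ (n : ℕ) where

  open At n

  σ₁⊛σ₃ : + 240 * (𝝈 1 ⊛ 𝝈 3) n ≡ + 21 * 𝝈 5 n + + 10 * 𝝈 3 n - 𝝈 1 n - + 30 * (+ n * 𝝈 3 n)
  σ₁⊛σ₃ = trans lhs₁₃ (trans (cong -_ (𝝈-relation Pℤ.F₁₃ Pℤ.K₁₃ (+ 30) Pℤ.ms₁₃ Pℤ.ps₁₃ Pℤ.even₁₃ Pℤ.antidifference₁₃ Pℤ.interior₁₃ Pℤ.boundary₁₃ n)) (rhs₁₃ (+ n)))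

  σ₃⊛σ₃ : + 120 * (𝝈 3 ⊛ 𝝈 3) n ≡ 𝝈 7 n - 𝝈 3 n
  σ₃⊛σ₃ = ℤ.*-cancelˡ-≡ (+ 3) (+ 120 * (𝝈 3 ⊛ 𝝈 3) n) (𝝈 7 n - 𝝈 3 n)
    (trans lhs₃₃ (trans (cong -_ (𝝈-relation Pℤ.F₃₃ Pℤ.K₃₃ (+ 60) Pℤ.ms₃₃ Pℤ.ps₃₃ Pℤ.even₃₃ Pℤ.antidifference₃₃ Pℤ.interior₃₃ Pℤ.boundary₃₃ n)) (rhs₃₃ (+ n))))

  σ₁⊛σ₅ : + 504 * (𝝈 1 ⊛ 𝝈 5) n ≡ + 20 * 𝝈 7 n + + 21 * 𝝈 5 n + 𝝈 1 n - + 42 * (+ n * 𝝈 5 n)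
  σ₁⊛σ₅ = ℤ.*-cancelˡ-≡ (+ 3) (+ 504 * (𝝈 1 ⊛ 𝝈 5) n) (+ 20 * 𝝈 7 n + + 21 * 𝝈 5 n + 𝝈 1 n - + 42 * (+ n * 𝝈 5 n))
    (trans lhs₁₅ (trans (cong -_ (𝝈-relation Pℤ.F₁₅ Pℤ.K₁₅ (+ 42) Pℤ.ms₁₅ Pℤ.ps₁₅ Pℤ.even₁₅ Pℤ.antidifference₁₅ Pℤ.interior₁₅ Pℤ.boundary₁₅ n)) (rhs₁₅ (+ n))))

  weight-12 : left₁₂ ≡ right₁₂
  weight-12 = trans lhs₃₇ (trans (cong -_ (𝝈-relation Pℤ.F₃₇ Pℤ.K₃₇ (+ 1260) Pℤ.ms₃₇ Pℤ.ps₃₇ Pℤ.even₃₇ Pℤ.antidifference₃₇ Pℤ.interior₃₇ Pℤ.boundary₃₇ n)) (rhs₃₇ (+ n)))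

-- Eisenstein series

eisenstein : ℤ → ℕ → Series
eisenstein c r = 𝟙 ⊕ c ⊙ 𝝈 r

-- The factors are -2k / B_k for the weights k = 2, 4, 6, 8, with B_k the Bernoulli numbers.
E₂ E₄ E₆ E₈ : Series
E₂ = eisenstein (- + 24) 1
E₄ = eisenstein (+ 240) 3
E₆ = eisenstein (- + 504) 5
E₈ = eisenstein (+ 480) 7

eisenstein-coefficient : ∀ c r n → eisenstein c r n ≡ 𝟙 n + c * 𝝈 r n
eisenstein-coefficient c r n = refl

eisenstein-⊛ : ∀ c r d s n → (eisenstein c r ⊛ eisenstein d s) n ≡ 𝟙 n + d * 𝝈 s n + (c * 𝝈 r n + c * (d * (𝝈 r ⊛ 𝝈 s) n))
eisenstein-⊛ c r d s n = begin
  (eisenstein c r ⊛ E) n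
    ≡⟨ ⊛-distribʳ-⊕ 𝟙 (c ⊙ 𝝈 r) E n ⟩
  (𝟙 ⊛ E) n + ((c ⊙ 𝝈 r) ⊛ E) n
    ≡⟨ cong₂ _+_ (⊛-identityˡ E n) (⊙-⊛ c (𝝈 r) E n) ⟩
  E n + c * (𝝈 r ⊛ E) n
    ≡⟨ cong (λ u → E n + c * u) (trans (⊛-distribˡ-⊕ (𝝈 r) 𝟙 (d ⊙ 𝝈 s) n) (cong₂ _+_ (⊛-identityʳ (𝝈 r) n) (⊛-⊙ (𝝈 r) d (𝝈 s) n))) ⟩
  E n + c * (𝝈 r n + d * (𝝈 r ⊛ 𝝈 s) n)
    ≡⟨ cong (λ u → E n + u) (ℤ.*-distribˡ-+ c (𝝈 r n) (d * (𝝈 r ⊛ 𝝈 s) n)) ⟩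
  E n + (c * 𝝈 r n + c * (d * (𝝈 r ⊛ 𝝈 s) n)) ∎
  where
  E : Series
  E = eisenstein d s

E₄² : E₄ ⊛ E₄ ≗ E₈
E₄² n = trans (eisenstein-⊛ (+ 240) 3 (+ 240) 3 n)
  (trans (collect (𝟙 n) (𝝈 3 n) (𝝈 7 n) ((𝝈 3 ⊛ 𝝈 3) n) (σ₃⊛σ₃ n)) (sym (eisenstein-coefficient (+ 480) 7 n)))
  where
  collect : ∀ e s₃ s₇ c → + 120 * c ≡ s₇ - s₃ → e + + 240 * s₃ + (+ 240 * s₃ + + 240 * (+ 240 * c)) ≡ e + + 480 * s₇
  collect e s₃ s₇ c relation = begin
    e + + 240 * s₃ + (+ 240 * s₃ + + 240 * (+ 240 * c))
      ≡⟨ solve 3 (λ e s₃ c → e :+ con (+ 240) :* s₃ :+ (con (+ 240) :* s₃ :+ con (+ 240) :* (con (+ 240) :* c))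
           := e :+ con (+ 480) :* (s₃ :+ con (+ 120) :* c)) refl e s₃ c ⟩
    e + + 480 * (s₃ + + 120 * c)
      ≡⟨ cong (λ u → e + + 480 * (s₃ + u)) relation ⟩
    e + + 480 * (s₃ + (s₇ - s₃))
      ≡⟨ solve 3 (λ e s₃ s₇ → e :+ con (+ 480) :* (s₃ :+ (s₇ :- s₃)) := e :+ con (+ 480) :* s₇) refl e s₃ s₇ ⟩
    e + + 480 * s₇ ∎

∂-eisenstein : ∀ c r n → ∂ (eisenstein c r) n ≡ c * (+ n * 𝝈 r n)
∂-eisenstein c r zero    = sym (trans (cong (c *_) (ℤ.*-zeroˡ (𝝈 r 0))) (ℤ.*-zeroʳ c))
∂-eisenstein c r (suc n) = solve 3 (λ n c s → n :* (con 0ℤ :+ c :* s) := c :* (n :* s)) refl (+ suc n) c (𝝈 r (suc n))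

∂E₄ : + 3 ⊙ ∂ E₄ ≗ (E₂ ⊛ E₄) ⊖ E₆
∂E₄ n = sym (begin
  (E₂ ⊛ E₄) n - E₆ n
    ≡⟨ cong (λ u → u - E₆ n) (eisenstein-⊛ (- + 24) 1 (+ 240) 3 n) ⟩
  𝟙 n + + 240 * 𝝈 3 n + (- + 24 * 𝝈 1 n + - + 24 * (+ 240 * (𝝈 1 ⊛ 𝝈 3) n)) - (𝟙 n + - + 504 * 𝝈 5 n)
    ≡⟨ cong (λ u → 𝟙 n + + 240 * 𝝈 3 n + (- + 24 * 𝝈 1 n + - + 24 * u) - (𝟙 n + - + 504 * 𝝈 5 n)) (σ₁⊛σ₃ n) ⟩
  𝟙 n + + 240 * 𝝈 3 n + (- + 24 * 𝝈 1 n + - + 24 * (+ 21 * 𝝈 5 n + + 10 * 𝝈 3 n - 𝝈 1 n - + 30 * (+ n * 𝝈 3 n))) - (𝟙 n + - + 504 * 𝝈 5 n)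
    ≡⟨ collect (𝟙 n) (𝝈 1 n) (𝝈 3 n) (𝝈 5 n) (+ n * 𝝈 3 n) ⟩
  + 3 * (+ 240 * (+ n * 𝝈 3 n))
    ≡⟨ cong (+ 3 *_) (sym (∂-eisenstein (+ 240) 3 n)) ⟩
  + 3 * ∂ E₄ n ∎)
  where
  collect : ∀ e s₁ s₃ s₅ t → e + + 240 * s₃ + (- + 24 * s₁ + - + 24 * (+ 21 * s₅ + + 10 * s₃ - s₁ - + 30 * t)) - (e + - + 504 * s₅) ≡ + 3 * (+ 240 * t)
  collect = solve 5 (λ e s₁ s₃ s₅ t → e :+ con (+ 240) :* s₃ :+ (con (- + 24) :* s₁ :+ con (- + 24) :* (con (+ 21) :* s₅ :+ con (+ 10) :* s₃ :- s₁ :- con (+ 30) :* t)) :- (e :+ con (- + 504) :* s₅)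
    := con (+ 3) :* (con (+ 240) :* t)) refl

∂E₆ : + 2 ⊙ ∂ E₆ ≗ (E₂ ⊛ E₆) ⊖ E₈
∂E₆ n = sym (begin
  (E₂ ⊛ E₆) n - E₈ n
    ≡⟨ cong (λ u → u - E₈ n) (eisenstein-⊛ (- + 24) 1 (- + 504) 5 n) ⟩
  𝟙 n + - + 504 * 𝝈 5 n + (- + 24 * 𝝈 1 n + - + 24 * (- + 504 * (𝝈 1 ⊛ 𝝈 5) n)) - (𝟙 n + + 480 * 𝝈 7 n)
    ≡⟨ cong (λ u → 𝟙 n + - + 504 * 𝝈 5 n + (- + 24 * 𝝈 1 n + - + 24 * u) - (𝟙 n + + 480 * 𝝈 7 n))
         (trans (sym (ℤ.neg-distribˡ-* (+ 504) ((𝝈 1 ⊛ 𝝈 5) n))) (cong -_ (σ₁⊛σ₅ n))) ⟩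
  𝟙 n + - + 504 * 𝝈 5 n + (- + 24 * 𝝈 1 n + - + 24 * - (+ 20 * 𝝈 7 n + + 21 * 𝝈 5 n + 𝝈 1 n - + 42 * (+ n * 𝝈 5 n))) - (𝟙 n + + 480 * 𝝈 7 n)
    ≡⟨ collect (𝟙 n) (𝝈 1 n) (𝝈 5 n) (𝝈 7 n) (+ n * 𝝈 5 n) ⟩
  + 2 * (- + 504 * (+ n * 𝝈 5 n))
    ≡⟨ cong (+ 2 *_) (sym (∂-eisenstein (- + 504) 5 n)) ⟩
  + 2 * ∂ E₆ n ∎)
  where
  collect : ∀ e s₁ s₅ s₇ t → e + - + 504 * s₅ + (- + 24 * s₁ + - + 24 * - (+ 20 * s₇ + + 21 * s₅ + s₁ - + 42 * t)) - (e + + 480 * s₇) ≡ + 2 * (- + 504 * t)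
  collect = solve 5 (λ e s₁ s₅ s₇ t → e :+ con (- + 504) :* s₅ :+ (con (- + 24) :* s₁ :+ con (- + 24) :* (:- (con (+ 20) :* s₇ :+ con (+ 21) :* s₅ :+ s₁ :- con (+ 42) :* t))) :- (e :+ con (+ 480) :* s₇)
    := con (+ 2) :* (con (- + 504) :* t)) refl

-- The discriminant and its logarithmic derivative

discriminant : Series
discriminant = (E₄ ⊛ E₈) ⊖ (E₆ ⊛ E₆)

∂-square : ∀ f → ∂ (f ⊛ f) ≗ + 2 ⊙ (f ⊛ ∂ f)
∂-square f n = begin
  ∂ (f ⊛ f) n                    ≡⟨ ∂-⊛ f f n ⟩
  (∂ f ⊛ f) n + (f ⊛ ∂ f) n      ≡⟨ cong (λ u → u + (f ⊛ ∂ f) n) (⊛-comm (∂ f) f n) ⟩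
  (f ⊛ ∂ f) n + (f ⊛ ∂ f) n      ≡⟨ double ((f ⊛ ∂ f) n) ⟩
  + 2 * (f ⊛ ∂ f) n              ∎
  where
  double : ∀ i → i + i ≡ + 2 * i
  double = solve 1 (λ i → i :+ i := con (+ 2) :* i) refl

-- The product is f³, with the square renamed g: for f = E₄ it is E₈.
∂-cube : ∀ f g → f ⊛ f ≗ g → ∂ (f ⊛ g) ≗ + 3 ⊙ (∂ f ⊛ g)
∂-cube f g f²≗g n = begin
  ∂ (f ⊛ g) n
    ≡⟨ ∂-⊛ f g n ⟩
  (∂ f ⊛ g) n + (f ⊛ ∂ g) n
    ≡⟨ cong (λ u → (∂ f ⊛ g) n + u) square ⟩
  (∂ f ⊛ g) n + + 2 * (∂ f ⊛ g) n
    ≡⟨ triple ((∂ f ⊛ g) n) ⟩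
  + 3 * (∂ f ⊛ g) n ∎
  where
  triple : ∀ i → i + + 2 * i ≡ + 3 * i
  triple = solve 1 (λ i → i :+ con (+ 2) :* i := con (+ 3) :* i) refl
  square : (f ⊛ ∂ g) n ≡ + 2 * (∂ f ⊛ g) n
  square = begin
    (f ⊛ ∂ g) n
      ≡⟨ ⊛-congʳ f (λ m → trans (cong (+ m *_) (sym (f²≗g m))) (∂-square f m)) n ⟩
    (f ⊛ (+ 2 ⊙ (f ⊛ ∂ f))) n
      ≡⟨ ⊛-⊙ f (+ 2) (f ⊛ ∂ f) n ⟩
    + 2 * (f ⊛ (f ⊛ ∂ f)) n
      ≡⟨ cong (+ 2 *_) (trans (sym (⊛-assoc f f (∂ f) n)) (trans (⊛-congˡ (∂ f) f²≗g n) (⊛-comm g (∂ f) n))) ⟩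
    + 2 * (∂ f ⊛ g) n ∎

-- The exponents 3 and 2 supply exactly the factors in `∂E₄` and `∂E₆`. The cube gives E₂ E₄ E₈ - E₆
-- E₈, the square E₂ E₆² - E₆ E₈, and the common term cancels.
∂log-discriminant : ∂log discriminant ≗ E₂
∂log-discriminant n = begin
  ∂ discriminant n
    ≡⟨ ∂-⊖ (E₄ ⊛ E₈) (E₆ ⊛ E₆) n ⟩
  ∂ (E₄ ⊛ E₈) n - ∂ (E₆ ⊛ E₆) n
    ≡⟨ cong₂ _-_ cube square ⟩
  ((E₂ ⊛ (E₄ ⊛ E₈)) n - (E₆ ⊛ E₈) n) - ((E₂ ⊛ (E₆ ⊛ E₆)) n - (E₆ ⊛ E₈) n)
    ≡⟨ cancel ((E₂ ⊛ (E₄ ⊛ E₈)) n) ((E₆ ⊛ E₈) n) ((E₂ ⊛ (E₆ ⊛ E₆)) n) ⟩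
  (E₂ ⊛ (E₄ ⊛ E₈)) n - (E₂ ⊛ (E₆ ⊛ E₆)) n
    ≡⟨ sym (⊛-distribˡ-⊖ E₂ (E₄ ⊛ E₈) (E₆ ⊛ E₆) n) ⟩
  (E₂ ⊛ discriminant) n ∎
  where
  cancel : ∀ i j k → (i - j) - (k - j) ≡ i - k
  cancel = solve 3 (λ i j k → (i :- j) :- (k :- j) := i :- k) refl
  cube : ∂ (E₄ ⊛ E₈) n ≡ (E₂ ⊛ (E₄ ⊛ E₈)) n - (E₆ ⊛ E₈) n
  cube = begin
    ∂ (E₄ ⊛ E₈) n
      ≡⟨ ∂-cube E₄ E₈ E₄² n ⟩
    + 3 * (∂ E₄ ⊛ E₈) n
      ≡⟨ sym (⊙-⊛ (+ 3) (∂ E₄) E₈ n) ⟩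
    ((+ 3 ⊙ ∂ E₄) ⊛ E₈) n
      ≡⟨ ⊛-congˡ E₈ ∂E₄ n ⟩
    (((E₂ ⊛ E₄) ⊖ E₆) ⊛ E₈) n
      ≡⟨ ⊛-distribʳ-⊖ (E₂ ⊛ E₄) E₆ E₈ n ⟩
    ((E₂ ⊛ E₄) ⊛ E₈) n - (E₆ ⊛ E₈) n
      ≡⟨ cong (λ u → u - (E₆ ⊛ E₈) n) (⊛-assoc E₂ E₄ E₈ n) ⟩
    (E₂ ⊛ (E₄ ⊛ E₈)) n - (E₆ ⊛ E₈) n ∎
  square : ∂ (E₆ ⊛ E₆) n ≡ (E₂ ⊛ (E₆ ⊛ E₆)) n - (E₆ ⊛ E₈) n
  square = begin
    ∂ (E₆ ⊛ E₆) n
      ≡⟨ ∂-square E₆ n ⟩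
    + 2 * (E₆ ⊛ ∂ E₆) n
      ≡⟨ cong (+ 2 *_) (⊛-comm E₆ (∂ E₆) n) ⟩
    + 2 * (∂ E₆ ⊛ E₆) n
      ≡⟨ sym (⊙-⊛ (+ 2) (∂ E₆) E₆ n) ⟩
    ((+ 2 ⊙ ∂ E₆) ⊛ E₆) n
      ≡⟨ ⊛-congˡ E₆ ∂E₆ n ⟩
    (((E₂ ⊛ E₆) ⊖ E₈) ⊛ E₆) n
      ≡⟨ ⊛-distribʳ-⊖ (E₂ ⊛ E₆) E₈ E₆ n ⟩
    ((E₂ ⊛ E₆) ⊛ E₆) n - (E₈ ⊛ E₆) n
      ≡⟨ cong₂ _-_ (⊛-assoc E₂ E₆ E₆ n) (⊛-comm E₈ E₆ n) ⟩
    (E₂ ⊛ (E₆ ⊛ E₆)) n - (E₆ ⊛ E₈) n ∎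

-- The logarithmic derivative of the product

∑-range-suc : ∀ n (f : ℕ → ℤ) → ∑ (range (suc n)) f ≡ ∑ (range n) f + f (suc n)
∑-range-suc n f = begin
  ∑ (range (suc n)) f                    ≡⟨ cong (λ is → ∑ (map suc is) f) (sym (applyUpTo-∷ʳ id n)) ⟩
  ∑ (map suc (upTo n ++ [ n ])) f        ≡⟨ cong (λ is → ∑ is f) (map-++ suc (upTo n) [ n ]) ⟩
  ∑ (range n ++ [ suc n ]) f             ≡⟨ ∑-++ (range n) [ suc n ] f ⟩
  ∑ (range n) f + (f (suc n) + 0ℤ)       ≡⟨ cong (λ u → ∑ (range n) f + u) (ℤ.+-identityʳ (f (suc n))) ⟩
  ∑ (range n) f + f (suc n)              ∎

q^-⊛-≥ : ∀ r f n → (q^ r ⊛ f) (r ℕ.+ n) ≡ f n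
q^-⊛-≥ zero    f n = ⊛-identityˡ f n
q^-⊛-≥ (suc r) f n = begin
  (q^ (suc r) ⊛ f) (suc r ℕ.+ n)                    ≡⟨ ⊛-suc (q^ (suc r)) f (r ℕ.+ n) ⟩
  0ℤ * f (suc r ℕ.+ n) + (q^ r ⊛ f) (r ℕ.+ n)       ≡⟨ cong₂ _+_ (ℤ.*-zeroˡ (f (suc r ℕ.+ n))) (q^-⊛-≥ r f n) ⟩
  0ℤ + f n                                          ≡⟨ ℤ.+-identityˡ (f n) ⟩
  f n                                               ∎

q^-⊛-< : ∀ {r n} f → n < r → (q^ r ⊛ f) n ≡ 0ℤ
q^-⊛-< {suc r} {zero}  f _         = trans (ℤ.+-identityʳ (0ℤ * f 0)) (ℤ.*-zeroˡ (f 0))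
q^-⊛-< {suc r} {suc n} f (s≤s n<r) = trans (⊛-suc (q^ (suc r)) f n)
  (cong₂ _+_ (ℤ.*-zeroˡ (f (suc n))) (q^-⊛-< f n<r))

-- The logarithmic derivative of 1 − q^r, namely − r q^r / (1 − q^r).
multiples : ℕ → Series
multiples r zero    = 0ℤ
multiples r (suc n) = - when (does (r ∣? suc n)) (+ r)

-- Multiplication by 1 - q^r takes differences at distance r. As r divides n exactly when it divides
-- n - r, these vanish except at n = r, where `multiples r 0` was set to 0.
∂log-1-q^r : ∀ r → 1 ≤ r → ∂log (𝟙 ⊖ q^ r) ≗ multiples r
∂log-1-q^r r 1≤r n = sym (begin
  (multiples r ⊛ (𝟙 ⊖ q^ r)) n
    ≡⟨ ⊛-distribˡ-⊖ (multiples r) 𝟙 (q^ r) n ⟩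
  (multiples r ⊛ 𝟙) n - (multiples r ⊛ q^ r) n
    ≡⟨ cong₂ _-_ (⊛-identityʳ (multiples r) n) (⊛-comm (multiples r) (q^ r) n) ⟩
  multiples r n - (q^ r ⊛ multiples r) n
    ≡⟨ coefficient r n 1≤r ⟩
  ∂ (𝟙 ⊖ q^ r) n ∎)
  where
  coefficient : ∀ r n → 1 ≤ r → multiples r n - (q^ r ⊛ multiples r) n ≡ ∂ (𝟙 ⊖ q^ r) n
  coefficient r n 1≤r with ℕ.<-≤-connex n r
  ... | inj₁ n<r = trans (cong₂ _-_ (multiples-< n n<r) (q^-⊛-< (multiples r) n<r)) (sym (∂-< n n<r))
    where
    multiples-< : ∀ n → n < r → multiples r n ≡ 0ℤ
    multiples-< zero    _   = refl
    multiples-< (suc n) n<r rewrite dec-false (r ∣? suc n) (ℕ.<⇒≱ n<r ∘ ∣⇒≤) = refl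
    ∂-< : ∀ n → n < r → ∂ (𝟙 ⊖ q^ r) n ≡ 0ℤ
    ∂-< zero    _   = ℤ.*-zeroˡ ((𝟙 ⊖ q^ r) 0)
    ∂-< (suc n) n<r = trans (cong (λ u → + suc n * (0ℤ - u)) (trans (sym (⊛-identityʳ (q^ r) (suc n))) (q^-⊛-< 𝟙 n<r))) (ℤ.*-zeroʳ (+ suc n))
  ... | inj₂ r≤n = subst (λ n → multiples r n - (q^ r ⊛ multiples r) n ≡ ∂ (𝟙 ⊖ q^ r) n) (ℕ.m+[n∸m]≡n r≤n)
    (trans (cong (λ u → multiples r (r ℕ.+ (n ∸ r)) - u) (q^-⊛-≥ r (multiples r) (n ∸ r))) (shifted r (n ∸ r) 1≤r))
    where
    q^-≥ : ∀ r m → q^ r (r ℕ.+ m) ≡ 𝟙 m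
    q^-≥ r m = trans (sym (⊛-identityʳ (q^ r) (r ℕ.+ m))) (q^-⊛-≥ r 𝟙 m)
    negate : ∀ i → - i - 0ℤ ≡ i * (0ℤ - 1ℤ)
    negate = solve 1 (λ i → :- i :- con 0ℤ := i :* (con 0ℤ :- con 1ℤ)) refl
    shifted : ∀ r m → 1 ≤ r → multiples r (r ℕ.+ m) - multiples r m ≡ ∂ (𝟙 ⊖ q^ r) (r ℕ.+ m)
    shifted (suc r) zero    _
      rewrite q^-≥ r 0 | ℕ.+-identityʳ r | dec-true (suc r ∣? suc r) ∣-refl = negate (+ suc r)
    shifted (suc r) (suc m) _
      rewrite q^-≥ r (suc m) | does-⇔ (mk⇔ (λ d → ∣m+n∣m⇒∣n d ∣-refl) (∣m∣n⇒∣m+n ∣-refl)) (suc r ∣? suc r ℕ.+ suc m) (suc r ∣? suc m)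
      = trans (ℤ.+-inverseʳ (- when (does (suc r ∣? suc m)) (+ suc r))) (sym (ℤ.*-zeroʳ (+ (suc r ℕ.+ suc m))))

∂log-euler : ∀ r → 1 ≤ r → ∂log (euler r) ≗ + 24 ⊙ multiples r
∂log-euler r 1≤r = ∂log-⊛^ {𝟙 ⊖ q^ r} {multiples r} 24 (∂log-1-q^r r 1≤r)

∂log-∏≤ : ∀ (f ℓ : ℕ → Series) → (∀ r → 1 ≤ r → ∂log (f r) ≗ ℓ r) → ∀ N → ∂log (∏≤ f N) ≗ λ n → ∑ (range N) (λ r → ℓ r n)
∂log-∏≤ f ℓ ∂f zero    = ∂log-𝟙
∂log-∏≤ f ℓ ∂f (suc N) = ∂log-cong {∏≤ f (suc N)} {ℓ (suc N) ⊕ partial}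
  (∂log-⊛ {f (suc N)} {∏≤ f N} {ℓ (suc N)} {partial} (∂f (suc N) (s≤s z≤n)) (∂log-∏≤ f ℓ ∂f N))
  (λ n → trans (ℤ.+-comm (ℓ (suc N) n) (partial n)) (sym (∑-range-suc N (λ r → ℓ r n))))
  where
  partial : Series
  partial n = ∑ (range N) (λ r → ℓ r n)

-- The factors r ≤ n already account for every divisor of i, since i ≤ n.
∑-multiples : ∀ n i → i ≤ n → ∑ (range n) (λ r → + 24 * multiples r i) ≡ - + 24 * 𝝈 1 i
∑-multiples n zero    _   = ∑-0 (range n)
∑-multiples n (suc i) i<n = begin
  ∑ (range n) (λ r → + 24 * - when (does (r ∣? suc i)) (+ r))
    ≡⟨ ∑-cong (range n) (λ r → negate (when (does (r ∣? suc i)) (+ r))) ⟩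
  ∑ (range n) (λ r → - + 24 * when (does (r ∣? suc i)) (+ r))
    ≡⟨ ∑-*ˡ (range n) (- + 24) (λ r → when (does (r ∣? suc i)) (+ r)) ⟩
  - + 24 * ∑ (range n) (λ r → when (does (r ∣? suc i)) (+ r))
    ≡⟨ cong (λ u → - + 24 * u) (sym (∑-filter (_∣? suc i) (range n) (λ d → + d))) ⟩
  - + 24 * ∑ (filter (_∣? suc i) (range n)) (λ d → + d)
    ≡⟨ cong (λ u → - + 24 * u) (∑-bijection ℕ._≟_ ℕ._≟_ (Unique.filter⁺ (_∣? suc i) (range-unique n)) (divisors-unique (suc i)) id id to from (λ d → + d)) ⟩
  - + 24 * ∑ (divisors (suc i)) (λ d → + d)
    ≡⟨ cong (λ u → - + 24 * u) (trans (∑-cong (divisors (suc i)) λ d → sym (ℤ.*-identityʳ (+ d))) (sym (σ-∑ 1 (suc i)))) ⟩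
  - + 24 * 𝝈 1 (suc i) ∎
  where
  negate : ∀ j → + 24 * - j ≡ - + 24 * j
  negate = solve 1 (λ j → con (+ 24) :* (:- j) := con (- + 24) :* j) refl
  to : ∀ {d} → d ∈ filter (_∣? suc i) (range n) → d ∈ divisors (suc i) × d ≡ d
  to d∈ = ∈-divisors⁺ (s≤s z≤n) (proj₂ (∈-filter⁻ (_∣? suc i) {xs = range n} d∈)) , refl
  from : ∀ {d} → d ∈ divisors (suc i) → d ∈ filter (_∣? suc i) (range n) × d ≡ d
  from {d} d∈ with d⁺ , _ , d∣i ← ∈-divisors⁻ {d} {suc i} d∈ =
    ∈-filter⁺ (_∣? suc i) (∈-range⁺ d⁺ (ℕ.≤-trans (∣⇒≤ d∣i) i<n)) d∣i , refl

-- Coefficient n involves only coefficients of index at most n, and there the infinite product and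
-- its derivative series agree with those of the n-th partial product.
∂log-∏∞ : ∂log (∏∞ euler) ≗ - + 24 ⊙ 𝝈 1
∂log-∏∞ n = trans (∂log-∏≤ euler (λ r → + 24 ⊙ multiples r) ∂log-euler n n)
  (⊛-cong {λ i → ∑ (range n) (λ r → + 24 * multiples r i)} { - + 24 ⊙ 𝝈 1} {∏≤ euler n} {∏∞ euler} n
    (∑-multiples n)
    (λ i i≤n → trans (cong (λ N → ∏≤ euler N i) (sym (ℕ.m∸n+n≡m i≤n))) (∏≤-stable euler euler-≡1 i (n ∸ i))))

∂log-q : ∂log (q^ 1) ≗ 𝟙
∂log-q zero          = refl
∂log-q (suc zero)    = refl
∂log-q (suc (suc n)) = trans (ℤ.*-zeroʳ (+ suc (suc n))) (sym (⊛-identityˡ (q^ 1) (suc (suc n))))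

∂log-τ : ∂log τ ≗ E₂
∂log-τ = ∂log-⊛ {q^ 1} {∏∞ euler} {𝟙} { - + 24 ⊙ 𝝈 1} ∂log-q ∂log-∏∞

-- The equation is linear, so f - c g solves it too and `∂log-vanish` applies.
∂log-unique : ∀ {f g ℓ} c → ∂log f ≗ ℓ → ∂log g ≗ ℓ → ℓ 0 ≡ 1ℤ → f 0 ≡ c * g 0 → f 1 ≡ c * g 1 → f ≗ c ⊙ g
∂log-unique {f} {g} {ℓ} c ∂f ∂g ℓ0 eq0 eq1 n =
  ℤ.i-j≡0⇒i≡j (f n) (c * g n) (∂log-vanish {f ⊖ (c ⊙ g)} {ℓ} ∂log-difference ℓ0 (ℤ.i≡j⇒i-j≡0 eq0) (ℤ.i≡j⇒i-j≡0 eq1) n)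
  where
  factor : ∀ c i j k → i * (j - c * k) ≡ i * j - c * (i * k)
  factor = solve 4 (λ c i j k → i :* (j :- c :* k) := i :* j :- c :* (i :* k)) refl
  ∂log-difference : ∂log (f ⊖ (c ⊙ g)) ≗ ℓ
  ∂log-difference n = begin
    ∂ (f ⊖ (c ⊙ g)) n
      ≡⟨ factor c (+ n) (f n) (g n) ⟩
    ∂ f n - c * ∂ g n
      ≡⟨ cong₂ (λ u v → u - c * v) (∂f n) (∂g n) ⟩
    (ℓ ⊛ f) n - c * (ℓ ⊛ g) n
      ≡⟨ cong (λ u → (ℓ ⊛ f) n - u) (sym (⊛-⊙ ℓ c g n)) ⟩
    (ℓ ⊛ f) n - (ℓ ⊛ (c ⊙ g)) n
      ≡⟨ sym (⊛-distribˡ-⊖ ℓ f (c ⊙ g) n) ⟩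
    (ℓ ⊛ (f ⊖ (c ⊙ g))) n ∎

-- The first two coefficients are compared by computation: 1 - 1 = 0, and (240 + 480) + 2 · 504 =
-- 1728 against τ(1) = 1.
discriminant≗1728τ : discriminant ≗ + 1728 ⊙ τ
discriminant≗1728τ = ∂log-unique {discriminant} {τ} {E₂} (+ 1728) ∂log-discriminant ∂log-τ refl refl refl

-- The formulas for τ

-- The polynomial identities use the power of an arbitrary semiring, the theorem that of ℤ.
^-≡ : ∀ x r → x ^ r ≡ x Pℤ.^ r
^-≡ x zero    = refl
^-≡ x (suc r) = cong (x *_) (^-≡ x r)

σ-∑-^ : ∀ r n → + σ r n ≡ ∑ (divisors n) (λ d → (+ d) ^ r)
σ-∑-^ r n = trans (σ-∑ r n) (∑-cong (divisors n) λ d → sym (^-≡ (+ d) r))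

-- Passing to unnormalised rationals avoids all gcd reductions: equality there is
-- cross-multiplication, which is the integer hypothesis up to factors 1 from the denominators of x
-- / 1 and y / 1.
/-combine : ∀ t p x q y k l .{{_ : NonZero k}} .{{_ : NonZero l}} →
  t * (+ k * + l) ≡ p * x * + l + q * y * + k → t / 1 ≡ (p / k) ℚ.* (x / 1) ℚ.+ (q / l) ℚ.* (y / 1)
/-combine t p x q y (suc k) (suc l) eq = ℚ.toℚᵘ-injective (begin-≃
  toℚᵘ (t / 1)
    ≈⟨ ℚ.toℚᵘ-fromℚᵘ (mkℚᵘ t 0) ⟩
  mkℚᵘ t 0
    ≈⟨ *≡* cross ⟩
  mkℚᵘ p k ℚᵘ.* mkℚᵘ x 0 ℚᵘ.+ mkℚᵘ q l ℚᵘ.* mkℚᵘ y 0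
    ≈⟨ ℚᵘ.+-cong (ℚᵘ.*-cong (ℚ.toℚᵘ-fromℚᵘ (mkℚᵘ p k)) (ℚ.toℚᵘ-fromℚᵘ (mkℚᵘ x 0)))
                 (ℚᵘ.*-cong (ℚ.toℚᵘ-fromℚᵘ (mkℚᵘ q l)) (ℚ.toℚᵘ-fromℚᵘ (mkℚᵘ y 0))) ⟨
  toℚᵘ (p / suc k) ℚᵘ.* toℚᵘ (x / 1) ℚᵘ.+ toℚᵘ (q / suc l) ℚᵘ.* toℚᵘ (y / 1)
    ≈⟨ ℚᵘ.+-cong (ℚ.toℚᵘ-homo-* (p / suc k) (x / 1)) (ℚ.toℚᵘ-homo-* (q / suc l) (y / 1)) ⟨
  toℚᵘ ((p / suc k) ℚ.* (x / 1)) ℚᵘ.+ toℚᵘ ((q / suc l) ℚ.* (y / 1))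
    ≈⟨ ℚ.toℚᵘ-homo-+ ((p / suc k) ℚ.* (x / 1)) ((q / suc l) ℚ.* (y / 1)) ⟨
  toℚᵘ ((p / suc k) ℚ.* (x / 1) ℚ.+ (q / suc l) ℚ.* (y / 1)) ∎-≃)
  where
  open ℚᵘ.≃-Reasoning using (step-≈-⟩; step-≈-⟨) renaming (begin_ to begin-≃_; _∎ to _∎-≃)
  cross : t * + ((suc k ℕ.* 1) ℕ.* (suc l ℕ.* 1)) ≡ (p * x * + (suc l ℕ.* 1) + q * y * + (suc k ℕ.* 1)) * + 1
  cross = begin
    t * + ((suc k ℕ.* 1) ℕ.* (suc l ℕ.* 1))
      ≡⟨ cong₂ (λ u v → t * + (u ℕ.* v)) (ℕ.*-identityʳ (suc k)) (ℕ.*-identityʳ (suc l)) ⟩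
    t * + (suc k ℕ.* suc l)
      ≡⟨ cong (t *_) (ℤ.pos-* (suc k) (suc l)) ⟩
    t * (+ suc k * + suc l)
      ≡⟨ eq ⟩
    p * x * + suc l + q * y * + suc k
      ≡⟨ cong₂ (λ u v → p * x * + v + q * y * + u) (ℕ.*-identityʳ (suc k)) (ℕ.*-identityʳ (suc l)) ⟨
    p * x * + (suc l ℕ.* 1) + q * y * + (suc k ℕ.* 1)
      ≡⟨ ℤ.*-identityʳ (p * x * + (suc l ℕ.* 1) + q * y * + (suc k ℕ.* 1)) ⟨
    (p * x * + (suc l ℕ.* 1) + q * y * + (suc k ℕ.* 1)) * + 1 ∎

discriminant-≡ : ∀ n → At.discriminant₁₂ n (𝟙 n) ≡ + 1728 * τ n
discriminant-≡ n = trans (sym expansion) (discriminant≗1728τ n)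
  where
  assoc : ∀ e u v c d x → e + u + (v + c * (d * x)) ≡ e + u + (v + c * d * x)
  assoc e u v c d x = cong (λ w → e + u + (v + w)) (sym (ℤ.*-assoc c d x))
  expansion : discriminant n ≡ At.discriminant₁₂ n (𝟙 n)
  expansion = cong₂ _-_
    (trans (eisenstein-⊛ (+ 240) 3 (+ 480) 7 n) (assoc (𝟙 n) (+ 480 * 𝝈 7 n) (+ 240 * 𝝈 3 n) (+ 240) (+ 480) ((𝝈 3 ⊛ 𝝈 7) n)))
    (trans (eisenstein-⊛ (- + 504) 5 (- + 504) 5 n) (assoc (𝟙 n) (- + 504 * 𝝈 5 n) (- + 504 * 𝝈 5 n) (- + 504) (- + 504) ((𝝈 5 ⊛ 𝝈 5) n)))

-- Both formulas have this shape and differ only in how x and y are written out.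
τ-formula : ∀ n {x y} → x ≡ At.weighted n → y ≡ (𝝈 3 ⊛ 𝝈 7) n - (𝝈 5 ⊛ 𝝈 5) n →
  τ n / 1 ≡ (+ 1 / (2 ℕ.^ 3 ℕ.* 3 ℕ.^ 5 ℕ.* 5 ℕ.* 7)) ℚ.* (x / 1) ℚ.+ (+ 691 * (+ 2) ^ 2 / (3 ℕ.^ 3)) ℚ.* (y / 1)
τ-formula n {x} {y} x≡ y≡ = /-combine (τ n) (+ 1) x (+ 691 * (+ 2) ^ 2) y (2 ℕ.^ 3 ℕ.* 3 ℕ.^ 5 ℕ.* 5 ℕ.* 7) (3 ℕ.^ 3)
  -- 68040 · 27 is not a multiple of 1728, but 8 times it is; so the identity is derived with a
  -- factor 8.
  (ℤ.*-cancelˡ-≡ (+ 8) (τ n * (+ 68040 * + 27)) (+ 1 * x * + 27 + + 2764 * y * + 68040)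
    (At.τ-combination n (𝟙 n) (τ n) x y (discriminant-≡ n) (weight-12 n) x≡ y≡))

-- The sums over 1, ..., n - 1 and over 0, ..., n are two readings of the same sum over
-- representations.
∑-range-convolution : ∀ n → ∑ (range (n ∸ 1)) (λ m → + σ 3 m * + σ 7 (n ∸ m) - + σ 5 m * + σ 5 (n ∸ m))
  ≡ (𝝈 3 ⊛ 𝝈 7) n - (𝝈 5 ⊛ 𝝈 5) n
∑-range-convolution n = trans
  (∑-- (range (n ∸ 1)) (λ m → + σ 3 m * + σ 7 (n ∸ m)) (λ m → + σ 5 m * + σ 5 (n ∸ m)))
  (cong₂ _-_ (convolution 3 7) (convolution 5 5))
  where
  ∈-range : ∀ {m} n → m < n → 1 ≤ m → m ∈ range (n ∸ 1)
  ∈-range (suc n) (s≤s m≤n) 1≤m = ∈-range⁺ 1≤m m≤n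
  convolution : ∀ r s → ∑ (range (n ∸ 1)) (λ m → + σ r m * + σ s (n ∸ m)) ≡ (𝝈 r ⊛ 𝝈 s) n
  convolution r s = begin
    ∑ (range (n ∸ 1)) (λ m → + σ r m * + σ s (n ∸ m))
      ≡⟨ ∑-cong (range (n ∸ 1)) (λ m → cong₂ _*_ (σ-∑ r m) (σ-∑ s (n ∸ m))) ⟩
    ∑ (range (n ∸ 1)) (λ m → ∑ (divisors m) (λ a → (+ a) Pℤ.^ r) * ∑ (divisors (n ∸ m)) (λ b → (+ b) Pℤ.^ s))
      ≡⟨ ∑-convolution n (λ a → (+ a) Pℤ.^ r) (λ b → (+ b) Pℤ.^ s) (range-unique (n ∸ 1)) (∈-range n) ⟨
    ∑ (reps n) (coeffs λ a b → (+ a) Pℤ.^ r * (+ b) Pℤ.^ s)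
      ≡⟨ ∑-reps-monomial r s n ⟩
    (𝝈 r ⊛ 𝝈 s) n ∎

∑-divisors-weighted : ∀ n → ∑ (divisors n) (λ d → (+ d) ^ 3 * (+ 3 * + 7 * + 691 + (+ 2) ^ 3 * + 5 * + 691 * (+ d) ^ 2
                               + + 2 * + 3 * + 7 * + 691 * (+ d) ^ 4 - + 13 * + 241 * (+ d) ^ 8)) ≡ At.weighted n
∑-divisors-weighted n = begin
  ∑ (divisors n) (λ d → (+ d) ^ 3 * (+ 3 * + 7 * + 691 + (+ 2) ^ 3 * + 5 * + 691 * (+ d) ^ 2
    + + 2 * + 3 * + 7 * + 691 * (+ d) ^ 4 - + 13 * + 241 * (+ d) ^ 8))
    ≡⟨ ∑-cong (divisors n) (λ d → expand (+ d)) ⟩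
  ∑ (divisors n) (λ d → + 14511 * (+ d) ^ 3 + + 27640 * (+ d) ^ 5 + + 29022 * (+ d) ^ 7 - + 3133 * (+ d) ^ 11)
    ≡⟨ trans (∑-- (divisors n) _ _) (cong₂ _-_ (trans (∑-+ (divisors n) _ _) (cong₂ _+_ (∑-+ (divisors n) _ _) refl)) refl) ⟩
  ∑ (divisors n) (λ d → + 14511 * (+ d) ^ 3) + ∑ (divisors n) (λ d → + 27640 * (+ d) ^ 5) + ∑ (divisors n) (λ d → + 29022 * (+ d) ^ 7) - ∑ (divisors n) (λ d → + 3133 * (+ d) ^ 11)
    ≡⟨ cong₂ _-_ (cong₂ _+_ (cong₂ _+_ (scaled (+ 14511) 3) (scaled (+ 27640) 5)) (scaled (+ 29022) 7)) (scaled (+ 3133) 11) ⟩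
  At.weighted n ∎
  where
  scaled : ∀ k r → ∑ (divisors n) (λ d → k * (+ d) ^ r) ≡ k * 𝝈 r n
  scaled k r = trans (∑-*ˡ (divisors n) k (λ d → (+ d) ^ r)) (cong (k *_) (sym (σ-∑-^ r n)))
  distribute : ∀ k₃ k₅ k₇ k₁₁ u v w z → u * (k₃ + k₅ * v + k₇ * w - k₁₁ * z) ≡ k₃ * u + k₅ * (u * v) + k₇ * (u * w) - k₁₁ * (u * z)
  distribute = solve 8 (λ k₃ k₅ k₇ k₁₁ u v w z → u :* (k₃ :+ k₅ :* v :+ k₇ :* w :- k₁₁ :* z)
    := k₃ :* u :+ k₅ :* (u :* v) :+ k₇ :* (u :* w) :- k₁₁ :* (u :* z)) refl
  -- The constants stay variables here; `expand` then instantiates them with products that evaluate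
  -- to 14511, 27640, 29022 and 3133.
  merge : ∀ k₃ k₅ k₇ k₁₁ x → x ^ 3 * (k₃ + k₅ * x ^ 2 + k₇ * x ^ 4 - k₁₁ * x ^ 8) ≡ k₃ * x ^ 3 + k₅ * x ^ 5 + k₇ * x ^ 7 - k₁₁ * x ^ 11
  merge k₃ k₅ k₇ k₁₁ x = begin
    x ^ 3 * (k₃ + k₅ * x ^ 2 + k₇ * x ^ 4 - k₁₁ * x ^ 8)
      ≡⟨ distribute k₃ k₅ k₇ k₁₁ (x ^ 3) (x ^ 2) (x ^ 4) (x ^ 8) ⟩
    k₃ * x ^ 3 + k₅ * (x ^ 3 * x ^ 2) + k₇ * (x ^ 3 * x ^ 4) - k₁₁ * (x ^ 3 * x ^ 8)
      ≡⟨ cong₂ (λ u v → u - k₁₁ * v)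
           (cong₂ (λ u v → k₃ * x ^ 3 + k₅ * u + k₇ * v) (ℤ.^-distribˡ-+-* x 3 2) (ℤ.^-distribˡ-+-* x 3 4)) (ℤ.^-distribˡ-+-* x 3 8) ⟨
    k₃ * x ^ 3 + k₅ * x ^ 5 + k₇ * x ^ 7 - k₁₁ * x ^ 11 ∎
  expand : ∀ x → x ^ 3 * (+ 3 * + 7 * + 691 + (+ 2) ^ 3 * + 5 * + 691 * x ^ 2 + + 2 * + 3 * + 7 * + 691 * x ^ 4 - + 13 * + 241 * x ^ 8)
    ≡ + 14511 * x ^ 3 + + 27640 * x ^ 5 + + 29022 * x ^ 7 - + 3133 * x ^ 11
  expand = merge (+ 3 * + 7 * + 691) ((+ 2) ^ 3 * + 5 * + 691) (+ 2 * + 3 * + 7 * + 691) (+ 13 * + 241)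

-- The summand a³ b⁷ - a⁵ b⁵ vanishes for a = b, so its sum over all representations is the sum of
-- its symmetrisation over a > b.
∑-coefficientPairs-convolution : ∀ n → ∑ (coefficientPairs n) (λ (m₁ , m₂) →
    (+ m₁ * + m₂) ^ 3 * ((+ m₁) ^ 2 - (+ m₂) ^ 2) ^ 2 * ∑ (solutions m₁ m₂ n) (λ y → 1ℤ))
  ≡ (𝝈 3 ⊛ 𝝈 7) n - (𝝈 5 ⊛ 𝝈 5) n
∑-coefficientPairs-convolution n = begin
  ∑ (coefficientPairs n) (λ (m₁ , m₂) → f m₁ m₂ * ∑ (solutions m₁ m₂ n) (λ y → 1ℤ))
    ≡⟨ ∑-coefficientPairs n f ⟨
  ∑ (filter b<a? (reps n)) (coeffs f)
    ≡⟨ ∑-cong (filter b<a? (reps n)) (λ (a , b , _) → symmetric (+ a) (+ b)) ⟩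
  ∑ (filter b<a? (reps n)) (coeffs λ a b → h b a + h a b)
    ≡⟨ ∑-swap-ab n (coeffs λ a b → h a b + h b a) ⟩
  ∑ (filter a<b? (reps n)) (coeffs λ a b → h a b + h b a)
    ≡⟨ ℤ.+-identityʳ _ ⟨
  ∑ (filter a<b? (reps n)) (coeffs λ a b → h a b + h b a) + 0ℤ
    ≡⟨ cong (λ u → ∑ (filter a<b? (reps n)) (coeffs λ a b → h a b + h b a) + u) diagonal ⟨
  ∑ (filter a<b? (reps n)) (coeffs λ a b → h a b + h b a) + ∑ (filter a≟b? (reps n)) (coeffs h)
    ≡⟨ ∑-split-ab n h ⟨
  ∑ (reps n) (coeffs h)
    ≡⟨ ∑-- (reps n) (coeffs λ a b → (+ a) Pℤ.^ 3 * (+ b) Pℤ.^ 7) (coeffs λ a b → (+ a) Pℤ.^ 5 * (+ b) Pℤ.^ 5) ⟩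
  ∑ (reps n) (coeffs λ a b → (+ a) Pℤ.^ 3 * (+ b) Pℤ.^ 7) - ∑ (reps n) (coeffs λ a b → (+ a) Pℤ.^ 5 * (+ b) Pℤ.^ 5)
    ≡⟨ cong₂ _-_ (∑-reps-monomial 3 7 n) (∑-reps-monomial 5 5 n) ⟩
  (𝝈 3 ⊛ 𝝈 7) n - (𝝈 5 ⊛ 𝝈 5) n ∎
  where
  f h : ℕ → ℕ → ℤ
  f a b = (+ a * + b) ^ 3 * ((+ a) ^ 2 - (+ b) ^ 2) ^ 2
  h a b = (+ a) Pℤ.^ 3 * (+ b) Pℤ.^ 7 - (+ a) Pℤ.^ 5 * (+ b) Pℤ.^ 5
  symmetric : ∀ x y → (x * y) ^ 3 * (x ^ 2 - y ^ 2) ^ 2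
    ≡ (y Pℤ.^ 3 * x Pℤ.^ 7 - y Pℤ.^ 5 * x Pℤ.^ 5) + (x Pℤ.^ 3 * y Pℤ.^ 7 - x Pℤ.^ 5 * y Pℤ.^ 5)
  symmetric x y = trans
    (cong₂ _*_ (^-≡ (x * y) 3) (trans (^-≡ (x ^ 2 - y ^ 2) 2) (cong₂ (λ u v → (u - v) Pℤ.^ 2) (^-≡ x 2) (^-≡ y 2))))
    (Pℤ.product-difference x y)
  zero-diagonal : ∀ a → h a a ≡ 0ℤ
  zero-diagonal a = trans
    (cong₂ _-_ (trans (cong₂ _*_ (sym (^-≡ (+ a) 3)) (sym (^-≡ (+ a) 7))) (sym (ℤ.^-distribˡ-+-* (+ a) 3 7)))
               (trans (cong₂ _*_ (sym (^-≡ (+ a) 5)) (sym (^-≡ (+ a) 5))) (sym (ℤ.^-distribˡ-+-* (+ a) 5 5))))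
    (ℤ.+-inverseʳ ((+ a) ^ 10))
  diagonal : ∑ (filter a≟b? (reps n)) (coeffs h) ≡ 0ℤ
  diagonal = trans (∑-cong∈ (filter a≟b? (reps n)) λ {t} → on-diagonal t) (∑-0 (filter a≟b? (reps n)))
    where
    on-diagonal : ∀ t → t ∈ filter a≟b? (reps n) → coeffs h t ≡ 0ℤ
    on-diagonal (a , b , x , y) t∈ with _ , refl ← ∈-filter⁻ a≟b? {xs = reps n} t∈ = zero-diagonal a

theorem1p10 : (n : ℕ) → .{{_ : NonZero n}} →
    (τ n / 1
      ≡ (+ 1 / (2 ℕ.^ 3 ℕ.* 3 ℕ.^ 5 ℕ.* 5 ℕ.* 7))
          ℚ.* ((+ 3 * + 7 * + 691 * + σ 3 n
                + (+ 2) ^ 3 * + 5 * + 691 * + σ 5 n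
                + + 2 * + 3 * + 7 * + 691 * + σ 7 n
                - + 13 * + 241 * + σ 11 n) / 1)
        ℚ.+ (+ 691 * (+ 2) ^ 2 / (3 ℕ.^ 3))
          ℚ.* ((∑[ m ∈ range (n ∸ 1) ]
                  (+ σ 3 m * + σ 7 (n ∸ m) - + σ 5 m * + σ 5 (n ∸ m))) / 1))
    ×
    (τ n / 1
      ≡ (+ 1 / (2 ℕ.^ 3 ℕ.* 3 ℕ.^ 5 ℕ.* 5 ℕ.* 7))
          ℚ.* ((∑[ d ∈ divisors n ]
                  ((+ d) ^ 3 * (+ 3 * + 7 * + 691
                                + (+ 2) ^ 3 * + 5 * + 691 * (+ d) ^ 2
                                + + 2 * + 3 * + 7 * + 691 * (+ d) ^ 4
                                - + 13 * + 241 * (+ d) ^ 8))) / 1)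
        ℚ.+ (+ 691 * (+ 2) ^ 2 / (3 ℕ.^ 3))
          ℚ.* (∑ (coefficientPairs n) (λ (m₁ , m₂) →
                  (+ m₁ * + m₂) ^ 3 * ((+ m₁) ^ 2 - (+ m₂) ^ 2) ^ 2
                    * (∑[ y ∈ solutions m₁ m₂ n ] 1ℤ)) / 1))
-- `refl` suffices for the first bracket, since its constant products evaluate to the numerals of
-- `weighted`.
theorem1p10 n = τ-formula n refl (∑-range-convolution n) , τ-formula n (∑-divisors-weighted n) (∑-coefficientPairs-convolution n)
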